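{- Let $a,b,s,h$ be positive integers with $s\ge 2$ and $r=a+b\ge 3$, and suppose that if $(a,b)=(1,r-1)$ then $h=1$. Then there exists a constant $C=C(r,s,h)>0$ such that every $n$-vertex $r$-uniform hypergraph $\mathcal H$ satisfying \[ |\mathcal H| > (s-1)\,|\partial \mathcal H| + C n^{r-2} \] contains the bush $\mathcal B_{s,h}(a,b)$.
   Context: An $r$-uniform hypergraph ($r$-graph) is identified with its edge set, a family of $r$-element subsets of its vertex set. The shadow $\partial\mathcal H$ of an $r$-graph $\mathcal H$ is the family of $(r-1)$-element sets contained in some edge of $\mathcal H$. For positive integers $a,b,s,h$ with $s\ge2$ and $r=a+b$, the bush $\mathcal B_{s,h}(a,b)$ is the $r$-graph constructed as follows: take pairwise disjoint sets $A$ with $|A|=a$, $B_1,\dots,B_s$ with $|B_i|=b$, and $A_{i,j}$ ($i\in[s]$, $j\in[h]$) with $|A_{i,j}|=a$; its edges are $A\cup B_i$ for $i\in[s]$ and $B_i\cup A_{i,j}$ for $i\in[s]$, $j\in[h]$. (It is the $(a,b)$-blowup of the graph tree obtained from the star $K_{1,s}$ by attaching $h$ new leaves to each leaf.) "$\mathcal H$ contains $\mathcal B_{s,h}(a,b)$" means $\mathcal H$ has a subfamily isomorphic to it. -}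

module Defs where

open import Data.Nat using (ℕ; zero; suc; _∸_)
open import Data.Nat.Properties using (_≟_)
open import Data.Bool using (Bool; true; false; _∧_)
open import Data.Bool.ListAction using (any)
open import Data.Fin using (Fin)
open import Data.Fin.Subset using (Subset; ∣_∣; _∪_; ⁅_⁆; ⊥; inside; outside)
open import Data.Fin.Subset.Properties using (_⊆?_)
open import Data.List using (List; []; _∷_; map; filter; length; foldr; allFin; _++_)
open import Data.Vec using (_∷_; [])
open import Data.Sum using (_⊎_; inj₁; inj₂)
open import Data.Product using (_×_; _,_)
open import Relation.Nullary.Decidable using (⌊_⌋)
open import Relation.Binary.PropositionalEquality using (_≡_)
open import Function.Definitions using (Injective)

allSubsets : (n : ℕ) → List (Subset n)
allSubsets zero = [] ∷ []
allSubsets (suc n) = map (outside ∷_) (allSubsets n) ++ map (inside ∷_) (allSubsets n)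

record Hypergraph (r n : ℕ) : Set where
  field
    edge    : Subset n → Bool
    uniform : ∀ S → edge S ≡ true → ∣ S ∣ ≡ r
open Hypergraph public

numEdges : ∀ {r n} → Hypergraph r n → ℕ
numEdges {n = n} H = length (filter (λ S → edge H S Data.Bool.≟ true) (allSubsets n))

inShadow : ∀ {r n} → Hypergraph r n → Subset n → Bool
inShadow {r} {n} H T =
  ⌊ ∣ T ∣ ≟ r ∸ 1 ⌋ ∧ any (λ e → edge H e ∧ ⌊ T ⊆? e ⌋) (allSubsets n)

shadowSize : ∀ {r n} → Hypergraph r n → ℕ
shadowSize {n = n} H = length (filter (λ T → inShadow H T Data.Bool.≟ true) (allSubsets n))

-- Vertex set of the bush B_{s,h}(a,b):
--   inj₁ k                   : k-th vertex of A           (k < a)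
--   inj₂ (inj₁ (i , k))      : k-th vertex of B_i         (i < s, k < b)
--   inj₂ (inj₂ (i , j , k))  : k-th vertex of A_{i,j}     (i < s, j < h, k < a)
BushV : (a b s h : ℕ) → Set
BushV a b s h = Fin a ⊎ (Fin s × Fin b) ⊎ (Fin s × Fin h × Fin a)

vA : ∀ {a b s h} → List (BushV a b s h)
vA {a} = map inj₁ (allFin a)

vB : ∀ {a b s h} → Fin s → List (BushV a b s h)
vB {b = b} i = map (λ k → inj₂ (inj₁ (i , k))) (allFin b)

vAij : ∀ {a b s h} → Fin s → Fin h → List (BushV a b s h)
vAij {a} i j = map (λ k → inj₂ (inj₂ (i , j , k))) (allFin a)

setOf : ∀ {n} → List (Fin n) → Subset n
setOf = foldr (λ v S → ⁅ v ⁆ ∪ S) ⊥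

ContainsBush : ∀ {r n} → Hypergraph r n → (a b s h : ℕ) → Set
ContainsBush {n = n} H a b s h =
  Data.Product.Σ (BushV a b s h → Fin n) λ f →
    Injective _≡_ _≡_ f
    × (∀ (i : Fin s) → edge H (setOf (map f (vA ++ vB i))) ≡ true)
    × (∀ (i : Fin s) (j : Fin h) → edge H (setOf (map f (vB i ++ vAij i j))) ≡ true)

{-# OPTIONS --safe #-}
module Submission where

-- Let L be large. By Füredi's intersection-semilattice idea, all but C n^(r-2) edges lie in families F
-- that are closed for some set N of coordinates: whenever |N ∖ P| ≠ 1, the restriction e|P of an edge
-- e ∈ F extends to a member of F avoiding, outside P, any prescribed L vertices. Otherwise every N
-- would yield a functional dependency P → q in a positive proportion of the family, and applying this
-- to N = {q : the other coordinates determine q} shows that r-2 coordinates determine the edge.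
--
-- A closed family contains the bush greedily if the coordinates split into parts of sizes a and b, each
-- meeting N in a set of size ≠ 1. This fails only if |N| = 1, or a = b = 2 and |N| = 3, or N is everything
-- and min(a,b) = 1. In those cases an edge e charges its faces e - u: for |N| = 1 its special vertex u makes
-- A ∪ u and e ∖ A kernels for every a-set A ⊆ e - u, so s edges T ∪ u_i with special u_i give a bush, and
-- each T ∈ ∂H is charged at most s-1 times. For a = 1 and N everything, an edge with at least two faces
-- able to pay 1/2 shares its charge; the others have two faces that are crowded or carry s-1 special
-- vertices, and a closed family of such edges contains the bush when h = 1.

open import Defs
open import Axiom.UniquenessOfIdentityProofs using (module Decidable⇒UIP)
open import Data.Bool using (Bool; true; false; _∧_; not)
import Data.Bool as 𝔹
open import Data.Bool.ListAction using (any)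
open import Data.Empty as Empty using (⊥-elim)
open import Data.Fin using (Fin; zero; suc; inject≤; punchIn; punchOut; funToFin; finToFun)
open import Data.Fin.Properties
  using (injective⇒≤; inject≤-injective; punchIn-punchOut; finToFun-funToFin; +↔⊎; *↔×)
  renaming (any? to anyFin?; all? to allFin?; _≟_ to _≟ᶠ_; suc-injective to sucᶠ-injective)
open import Data.Fin.Subset
open import Data.Fin.Subset.Properties
open import Data.List using (List; []; _∷_; map; filter; length; allFin; _++_; cartesianProduct)
import Data.List as List
open import Data.List.Membership.Propositional using (find; lose) renaming (_∈_ to _∈ˡ_)
open import Data.List.Membership.Propositional.Properties
  using (∈-map⁺; ∈-map⁻; ∈-++⁺ˡ; ∈-++⁺ʳ; ∈-filter⁺; ∈-filter⁻; ∈-lookup; ∈-cartesianProduct⁺; ∈-allFin)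
open import Data.List.Properties using (filter-notAll; length-map; map-++; map-cong; map-tabulate; map-∘)
open import Data.List.Relation.Unary.All as All using (All; []; _∷_)
open import Data.List.Relation.Unary.AllPairs using ([]; _∷_)
open import Data.List.Relation.Unary.Any as Any using (Any)
open import Data.List.Relation.Unary.Unique.Propositional using (Unique)
import Data.List.Relation.Unary.Unique.Propositional.Properties as Unique
open import Data.Nat using (ℕ; zero; suc; pred; _+_; _*_; _∸_; _^_; _≤_; _<_; z≤n; s≤s; _≤?_; _<?_)
import Data.Nat as ℕ
open import Data.Nat.Properties
  using (≤-refl; ≤-trans; ≤-reflexive; ≤-antisym; ≤-pred; ≤∧≢⇒<; ≰⇒>; ≮⇒≥; <⇒≱; n≤1+n; 0≢1+n;
         +-mono-≤; +-monoˡ-≤; +-monoʳ-≤; *-monoˡ-≤; *-monoʳ-≤; m≤m+n; m≤n+m; m≤n⇒∃[o]m+o≡n; m+[n∸m]≡n;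
         +-comm; +-assoc; +-suc; +-identityʳ; *-comm; *-assoc; *-distribˡ-+; *-identityˡ; *-identityʳ; *-zeroʳ;
         +-cancelˡ-≡; +-cancelˡ-≤; +-cancelʳ-≤; *-cancelˡ-≤; module ≤-Reasoning)
open import Data.Nat.Solver using (module +-*-Solver)
open import Data.Product using (Σ; ∃; _×_; _,_; proj₁; proj₂)
open import Data.Product.Function.NonDependent.Propositional using (_×-↔_)
open import Data.Product.Properties using () renaming (≡-dec to ×-≡-dec)
open import Data.Sum using (_⊎_; inj₁; inj₂; [_,_]′)
open import Data.Sum.Function.Propositional using (_⊎-↔_)
open import Data.Sum.Properties using () renaming (≡-dec to ⊎-≡-dec)
open import Data.Vec using (_∷_; []; here; there; tabulate; lookup)
open import Data.Vec.Properties using ([]=⇒lookup; lookup⇒[]=; lookup∘tabulate; ∷-injectiveʳ)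
  renaming (≡-dec to Vec-≡-dec)
open import Function using (_∘_; id; case_of_)
open import Function.Bundles using (_↔_; Inverse)
open import Function.Construct.Composition using (_↔-∘_)
open import Function.Construct.Identity using (↔-id)
open import Function.Definitions using (Injective)
open import Relation.Binary.PropositionalEquality
  using (_≡_; _≢_; refl; sym; trans; cong; cong₂; subst; subst₂)
open import Relation.Nullary using (¬_; Dec; yes; no; does; contradiction)
open import Relation.Nullary.Decidable using (_×-dec_; _→-dec_; ¬?; map′; isYes≗does; decidable-stable)

-- The coefficient `s ∸ 1` has to come out exactly, so replacing the hypergraph by a subfamily of
-- positive proportion is not affordable. Only the edges that their faces do not pay in full are
-- searched for closed families: if there were more than C n^(r-2) of them, they would contain a
-- nonempty closed family (with all edges of one kind when a = 1), which is impossible without a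
-- bush.
--
-- The exclusion of |N ∖ P| = 1 is dictated by the exponent r-2. A dependency P → q with q ∈ N ∖ P
-- saves one coordinate; a second element of N ∖ P, determined by all the other coordinates, saves
-- another. The set N to which this applies is known only when the subfamily is, so the edges are
-- first classified for all 2^r sets N. The number of classes does not depend on n.
--
-- For a = 1 and N everything, a face can serve as a stem without being a kernel: a second neighbour
-- is its leaf. Such a face is only known to have boundedly many neighbours, which is why one leaf
-- per stem is all that can be asked for.

variable
  n : ℕ

-- Finite subsets: disjointness, size and enumeration

Disjoint : Subset n → Subset n → Set
Disjoint p q = ∀ {x} → x ∈ p → x ∉ q

Disjoint-sym : {p q : Subset n} → Disjoint p q → Disjoint q p
Disjoint-sym d x∈q x∈p = d x∈p x∈q

Disjoint-∪ʳ : {p q₁ q₂ : Subset n} → Disjoint p q₁ → Disjoint p q₂ → Disjoint p (q₁ ∪ q₂)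
Disjoint-∪ʳ {q₁ = q₁} {q₂} d₁ d₂ x∈p x∈q with x∈p∪q⁻ q₁ q₂ x∈q
... | inj₁ x∈q₁ = d₁ x∈p x∈q₁
... | inj₂ x∈q₂ = d₂ x∈p x∈q₂

Disjoint-∪ˡ : {p₁ p₂ q : Subset n} → Disjoint p₁ q → Disjoint p₂ q → Disjoint (p₁ ∪ p₂) q
Disjoint-∪ˡ {p₁ = p₁} {p₂} {q} d₁ d₂ =
  Disjoint-sym {p = q} (Disjoint-∪ʳ {p = q} {p₁} {p₂} (Disjoint-sym {p = p₁} d₁) (Disjoint-sym {p = p₂} d₂))

∈∪ˡ : ∀ {x} {p q : Subset n} → x ∈ p → x ∈ p ∪ q
∈∪ˡ {q = q} = p⊆p∪q q

∈∪ʳ : ∀ {x} {p q : Subset n} → x ∈ q → x ∈ p ∪ q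
∈∪ʳ {p = p} {q} = q⊆p∪q p q

∪-⊆ : {p q t : Subset n} → p ⊆ t → q ⊆ t → p ∪ q ⊆ t
∪-⊆ {p = p} {q} p⊆t q⊆t x∈ = [ p⊆t , q⊆t ]′ (x∈p∪q⁻ p q x∈)

⁅⁆-⊆ : ∀ {x} {p : Subset n} → x ∈ p → ⁅ x ⁆ ⊆ p
⁅⁆-⊆ {x = x} {p} x∈p y∈ = subst (_∈ p) (sym (x∈⁅y⁆⇒x≡y x y∈)) x∈p

∉⇒Disjoint-⁅⁆ : ∀ {x} {p : Subset n} → x ∉ p → Disjoint ⁅ x ⁆ p
∉⇒Disjoint-⁅⁆ {x = x} {p} x∉p y∈ y∈p = x∉p (subst (_∈ p) (x∈⁅y⁆⇒x≡y x y∈) y∈p)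

x∈p─q⁻ : ∀ {x} (p q : Subset n) → x ∈ p ─ q → x ∈ p × x ∉ q
x∈p─q⁻ (true ∷ p) (false ∷ q) here = here , λ ()
x∈p─q⁻ (_ ∷ p) (true ∷ q) (there x∈) =
  let x∈p , x∉q = x∈p─q⁻ p q x∈ in there x∈p , λ { (there x∈q) → x∉q x∈q }
x∈p─q⁻ (_ ∷ p) (false ∷ q) (there x∈) =
  let x∈p , x∉q = x∈p─q⁻ p q x∈ in there x∈p , λ { (there x∈q) → x∉q x∈q }

p∪q─p≡q : {p q : Subset n} → Disjoint p q → (p ∪ q) ─ p ≡ q
p∪q─p≡q {p = p} {q} p#q = ⊆-antisym
  (λ x∈ → let x∈∪ , x∉p = x∈p─q⁻ (p ∪ q) p x∈
          in [ (λ x∈p → contradiction x∈p x∉p) , id ]′ (x∈p∪q⁻ p q x∈∪))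
  (λ x∈q → x∈p∧x∉q⇒x∈p─q (∈∪ʳ {p = p} x∈q) (λ x∈p → p#q x∈p x∈q))

p∪[q─p]≡q : {p q : Subset n} → p ⊆ q → p ∪ (q ─ p) ≡ q
p∪[q─p]≡q {p = p} {q} p⊆q = ⊆-antisym
  (∪-⊆ {p = p} {q ─ p} p⊆q (λ x∈ → proj₁ (x∈p─q⁻ q p x∈)))
  λ {x} x∈q → case x ∈? p of λ
    { (yes x∈p) → ∈∪ˡ {q = q ─ p} x∈p
    ; (no x∉p) → ∈∪ʳ {p = p} (x∈p∧x∉q⇒x∈p─q x∈q x∉p) }

[p-x]∪⁅x⁆≡p : ∀ {x} {p : Subset n} → x ∈ p → (p - x) ∪ ⁅ x ⁆ ≡ p
[p-x]∪⁅x⁆≡p {x = x} {p} x∈p = trans (∪-comm (p - x) ⁅ x ⁆) (p∪[q─p]≡q (⁅⁆-⊆ x∈p))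

p∪⁅x⁆-x≡p : ∀ {x} {p : Subset n} → x ∉ p → (p ∪ ⁅ x ⁆) - x ≡ p
p∪⁅x⁆-x≡p {x = x} {p} x∉p =
  trans (cong (_- x) (∪-comm p ⁅ x ⁆)) (p∪q─p≡q (∉⇒Disjoint-⁅⁆ x∉p))

x∉p-x : ∀ {x} {p : Subset n} → x ∉ p - x
x∉p-x {x = x} {p} x∈ = proj₂ (x∈p─q⁻ p ⁅ x ⁆ x∈) (x∈⁅x⁆ x)

p-x⊆p : ∀ {x} {p : Subset n} → p - x ⊆ p
p-x⊆p {x = x} {p} y∈ = proj₁ (x∈p─q⁻ p ⁅ x ⁆ y∈)

∣p∪q∣≡∣p∣+∣q∣ : {p q : Subset n} → Disjoint p q → ∣ p ∪ q ∣ ≡ ∣ p ∣ + ∣ q ∣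
∣p∪q∣≡∣p∣+∣q∣ {p = []} {[]} d = refl
∣p∪q∣≡∣p∣+∣q∣ {p = true ∷ p} {true ∷ q} d = contradiction here (d here)
∣p∪q∣≡∣p∣+∣q∣ {p = true ∷ p} {false ∷ q} d = cong suc (∣p∪q∣≡∣p∣+∣q∣ λ x∈p x∈q → d (there x∈p) (there x∈q))
∣p∪q∣≡∣p∣+∣q∣ {p = false ∷ p} {true ∷ q} d =
  trans (cong suc (∣p∪q∣≡∣p∣+∣q∣ {p = p} {q} λ x∈p x∈q → d (there x∈p) (there x∈q))) (sym (+-suc ∣ p ∣ ∣ q ∣))
∣p∪q∣≡∣p∣+∣q∣ {p = false ∷ p} {false ∷ q} d = ∣p∪q∣≡∣p∣+∣q∣ {p = p} {q} λ x∈p x∈q → d (there x∈p) (there x∈q)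

∣p∪q∣≤∣p∣+∣q∣ : (p q : Subset n) → ∣ p ∪ q ∣ ≤ ∣ p ∣ + ∣ q ∣
∣p∪q∣≤∣p∣+∣q∣ [] [] = z≤n
∣p∪q∣≤∣p∣+∣q∣ (true ∷ p) (true ∷ q) = s≤s (≤-trans (∣p∪q∣≤∣p∣+∣q∣ p q) (+-monoʳ-≤ ∣ p ∣ (n≤1+n ∣ q ∣)))
∣p∪q∣≤∣p∣+∣q∣ (true ∷ p) (false ∷ q) = s≤s (∣p∪q∣≤∣p∣+∣q∣ p q)
∣p∪q∣≤∣p∣+∣q∣ (false ∷ p) (true ∷ q) =
  ≤-trans (s≤s (∣p∪q∣≤∣p∣+∣q∣ p q)) (≤-reflexive (sym (+-suc ∣ p ∣ ∣ q ∣)))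
∣p∪q∣≤∣p∣+∣q∣ (false ∷ p) (false ∷ q) = ∣p∪q∣≤∣p∣+∣q∣ p q

∣p∣+∣q─p∣≡∣q∣ : {p q : Subset n} → p ⊆ q → ∣ p ∣ + ∣ q ─ p ∣ ≡ ∣ q ∣
∣p∣+∣q─p∣≡∣q∣ {p = p} {q} p⊆q =
  trans (sym (∣p∪q∣≡∣p∣+∣q∣ {p = p} {q ─ p} λ x∈p x∈ → proj₂ (x∈p─q⁻ q p x∈) x∈p)) (cong ∣_∣ (p∪[q─p]≡q p⊆q))

∣p-x∣+1≡∣p∣ : ∀ {x} {p : Subset n} → x ∈ p → suc ∣ p - x ∣ ≡ ∣ p ∣
∣p-x∣+1≡∣p∣ {x = x} {p} x∈p =
  trans (cong (_+ ∣ p - x ∣) (sym (∣⁅x⁆∣≡1 x))) (∣p∣+∣q─p∣≡∣q∣ (⁅⁆-⊆ x∈p))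

∣p∪⁅x⁆∣≡1+∣p∣ : ∀ {x} {p : Subset n} → x ∉ p → ∣ p ∪ ⁅ x ⁆ ∣ ≡ suc ∣ p ∣
∣p∪⁅x⁆∣≡1+∣p∣ {x = x} {p} x∉p =
  trans (∣p∪q∣≡∣p∣+∣q∣ (Disjoint-sym {p = ⁅ x ⁆} (∉⇒Disjoint-⁅⁆ x∉p)))
        (trans (cong (∣ p ∣ +_) (∣⁅x⁆∣≡1 x)) (+-comm ∣ p ∣ 1))

⊆∧∣∣≥⇒⊇ : {p q : Subset n} → p ⊆ q → ∣ q ∣ ≤ ∣ p ∣ → q ⊆ p
⊆∧∣∣≥⇒⊇ {p = p} p⊆q ∣q∣≤∣p∣ {x} x∈q with x ∈? p
... | yes x∈p = x∈p
... | no x∉p = contradiction ∣q∣≤∣p∣ (<⇒≱ (p⊂q⇒∣p∣<∣q∣ (p⊆q , x , x∈q , x∉p)))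

enum : (p : Subset n) → Fin ∣ p ∣ → Fin n
enum (true ∷ p) zero = zero
enum (true ∷ p) (suc i) = suc (enum p i)
enum (false ∷ p) i = suc (enum p i)

enum-∈ : (p : Subset n) (i : Fin ∣ p ∣) → enum p i ∈ p
enum-∈ (true ∷ p) zero = here
enum-∈ (true ∷ p) (suc i) = there (enum-∈ p i)
enum-∈ (false ∷ p) i = there (enum-∈ p i)

enum-injective : (p : Subset n) {i j : Fin ∣ p ∣} → enum p i ≡ enum p j → i ≡ j
enum-injective (true ∷ p) {zero} {zero} eq = refl
enum-injective (true ∷ p) {suc i} {suc j} eq = cong suc (enum-injective p (sucᶠ-injective eq))
enum-injective (false ∷ p) eq = enum-injective p (sucᶠ-injective eq)

rank : ∀ {x} (p : Subset n) → x ∈ p → Fin ∣ p ∣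
rank (true ∷ p) here = zero
rank (true ∷ p) (there x∈p) = suc (rank p x∈p)
rank (false ∷ p) (there x∈p) = rank p x∈p

enum-rank : ∀ {x} (p : Subset n) (x∈p : x ∈ p) → enum p (rank p x∈p) ≡ x
enum-rank (true ∷ p) here = refl
enum-rank (true ∷ p) (there x∈p) = cong suc (enum-rank p x∈p)
enum-rank (false ∷ p) (there x∈p) = cong suc (enum-rank p x∈p)

rank-injective : ∀ {x y} (p : Subset n) (x∈p : x ∈ p) (y∈p : y ∈ p) → rank p x∈p ≡ rank p y∈p → x ≡ y
rank-injective p x∈p y∈p eq = trans (sym (enum-rank p x∈p)) (trans (cong (enum p) eq) (enum-rank p y∈p))

injection⇒≤∣∣ : ∀ {k} (p : Subset n) (f : Fin k → Fin n) →
  (∀ i → f i ∈ p) → (∀ {i j} → f i ≡ f j → i ≡ j) → k ≤ ∣ p ∣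
injection⇒≤∣∣ p f f∈p f-inj =
  injective⇒≤ {f = λ i → rank p (f∈p i)} λ {i} {j} eq → f-inj (rank-injective p (f∈p i) (f∈p j) eq)

≤∣∣⇒injection : ∀ {k} (p : Subset n) → k ≤ ∣ p ∣ →
  Σ (Fin k → Fin n) λ f → (∀ i → f i ∈ p) × (∀ {i j} → f i ≡ f j → i ≡ j)
≤∣∣⇒injection p k≤ = (λ i → enum p (inject≤ i k≤)) , (λ i → enum-∈ p (inject≤ i k≤)) ,
  λ {i} {j} eq → inject≤-injective k≤ k≤ i j (enum-injective p eq)

∈-tabulate⁻ : ∀ {f : Fin n → Bool} {x} → x ∈ tabulate f → f x ≡ true
∈-tabulate⁻ {f = f} {x} x∈ = trans (sym (lookup∘tabulate f x)) ([]=⇒lookup x∈)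

∈-tabulate⁺ : ∀ {f : Fin n → Bool} {x} → f x ≡ true → x ∈ tabulate f
∈-tabulate⁺ {f = f} {x} eq = lookup⇒[]= x (tabulate f) (trans (lookup∘tabulate f x) eq)

does-true⁻ : {A : Set} (A? : Dec A) → does A? ≡ true → A
does-true⁻ (yes a) _ = a

does-true⁺ : {A : Set} (A? : Dec A) → A → does A? ≡ true
does-true⁺ (yes _) _ = refl
does-true⁺ (no ¬a) a = contradiction a ¬a

⟦_⟧ : {Q : Fin n → Set} → (∀ x → Dec (Q x)) → Subset n
⟦ Q? ⟧ = tabulate (λ x → does (Q? x))

module _ {Q : Fin n → Set} (Q? : ∀ x → Dec (Q x)) where
  ∈⟦⟧⁻ : ∀ {x} → x ∈ ⟦ Q? ⟧ → Q x
  ∈⟦⟧⁻ {x} x∈ = does-true⁻ (Q? x) (∈-tabulate⁻ x∈)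

  ∈⟦⟧⁺ : ∀ {x} → Q x → x ∈ ⟦ Q? ⟧
  ∈⟦⟧⁺ {x} q = ∈-tabulate⁺ (does-true⁺ (Q? x) q)

⊆-of-size : (p : Subset n) (k : ℕ) → k ≤ ∣ p ∣ → Σ (Subset n) λ q → q ⊆ p × ∣ q ∣ ≡ k
⊆-of-size {n} p zero _ = ⊥ , (λ x∈⊥ → contradiction x∈⊥ ∉⊥) , ∣⊥∣≡0 n
⊆-of-size (true ∷ p) (suc k) (s≤s k≤) =
  let q , q⊆p , ∣q∣≡k = ⊆-of-size p k k≤ in true ∷ q , in⊆in q⊆p , cong suc ∣q∣≡k
⊆-of-size (false ∷ p) (suc k) k≤ =
  let q , q⊆p , ∣q∣≡k = ⊆-of-size p (suc k) k≤ in false ∷ q , out⊆ q⊆p , ∣q∣≡k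

allSubset? : {Q : Subset n → Set} → (∀ p → Dec (Q p)) → Dec (∀ p → Q p)
allSubset? Q? = map′ (λ ¬∃ p → decidable-stable (Q? p) λ ¬q → ¬∃ (p , ¬q)) (λ all (p , ¬q) → ¬q (all p))
  (¬? (anySubset? λ p → ¬? (Q? p)))

Disjoint? : (p q : Subset n) → Dec (Disjoint p q)
Disjoint? p q = map′ (λ all {x} → all x) (λ d x → d {x}) (allFin? λ x → (x ∈? p) →-dec ¬? (x ∈? q))

-- Finite unions and the greedy choice of disjoint sets

⋃ᶠ : ∀ {m} → (Fin m → Subset n) → Subset n
⋃ᶠ {m = zero} P = ⊥
⋃ᶠ {m = suc m} P = P zero ∪ ⋃ᶠ (P ∘ suc)

∣⋃ᶠ∣≤ : ∀ {m w} (P : Fin m → Subset n) → (∀ i → ∣ P i ∣ ≤ w) → ∣ ⋃ᶠ P ∣ ≤ m * w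
∣⋃ᶠ∣≤ {n} {zero} P P≤ = ≤-reflexive (∣⊥∣≡0 n)
∣⋃ᶠ∣≤ {n} {suc m} P P≤ = ≤-trans (∣p∪q∣≤∣p∣+∣q∣ (P zero) _) (+-mono-≤ (P≤ zero) (∣⋃ᶠ∣≤ (P ∘ suc) (P≤ ∘ suc)))

∈⋃ᶠ⁻ : ∀ {m} (P : Fin m → Subset n) {x} → x ∈ ⋃ᶠ P → ∃ λ i → x ∈ P i
∈⋃ᶠ⁻ {m = zero} P x∈ = contradiction x∈ ∉⊥
∈⋃ᶠ⁻ {m = suc m} P x∈ with x∈p∪q⁻ (P zero) _ x∈
... | inj₁ x∈P = zero , x∈P
... | inj₂ x∈⋃ = let i , x∈P = ∈⋃ᶠ⁻ (P ∘ suc) x∈⋃ in suc i , x∈P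

∈⋃ᶠ⁺ : ∀ {m} (P : Fin m → Subset n) {x} i → x ∈ P i → x ∈ ⋃ᶠ P
∈⋃ᶠ⁺ P zero x∈ = ∈∪ˡ {q = ⋃ᶠ (P ∘ suc)} x∈
∈⋃ᶠ⁺ P (suc i) x∈ = ∈∪ʳ {p = P zero} (∈⋃ᶠ⁺ (P ∘ suc) i x∈)

-- Greedy choice of pairwise disjoint sets; the core Q i is reserved for the i-th choice.
greedy : ∀ (L w k : ℕ) (Good : Fin k → Subset n → Set) (Q : Fin k → Subset n) →
  (∀ i → ∣ Q i ∣ ≤ w) → (∀ {i j} → i ≢ j → Disjoint (Q i) (Q j)) →
  (∀ i X → ∣ X ∣ ≤ L → Disjoint (Q i) X → Σ (Subset n) λ V → ∣ V ∣ ≤ w × Disjoint V X × Good i V) →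
  (X : Subset n) → (∀ i → Disjoint (Q i) X) → ∣ X ∣ + k * w ≤ L + w →
  Σ (Fin k → Subset n) λ V → (∀ i → Good i (V i)) × (∀ i → ∣ V i ∣ ≤ w) × (∀ i → Disjoint (V i) X) ×
    (∀ {i j} → i ≢ j → Disjoint (V i) (V j))
greedy L w zero Good Q Q≤ Q# find X QX ≤L = (λ ()) , (λ ()) , (λ ()) , (λ ()) , λ { {()} }
greedy {n} L w (suc k) Good Q Q≤ Q# find X QX ≤L = V , good , V≤ , VX , V#
  where
  rest : Subset n
  rest = ⋃ᶠ (Q ∘ suc)
  -- The surplus `w` in the hypothesis pays for the set being chosen: it has to avoid only `X` and
  -- the `k` later cores.
  bound : ∣ X ∣ + k * w ≤ L
  bound = +-cancelʳ-≤ w _ _ (≤-trans (≤-reflexive (trans (+-assoc ∣ X ∣ (k * w) w) (cong (∣ X ∣ +_) (+-comm (k * w) w)))) ≤L)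
  first : Σ (Subset n) λ V → ∣ V ∣ ≤ w × Disjoint V (X ∪ rest) × Good zero V
  first = find zero (X ∪ rest)
    (≤-trans (∣p∪q∣≤∣p∣+∣q∣ X rest) (≤-trans (+-monoʳ-≤ ∣ X ∣ (∣⋃ᶠ∣≤ (Q ∘ suc) (Q≤ ∘ suc))) bound))
    (Disjoint-∪ʳ {q₁ = X} {rest} (QX zero) λ x∈Q x∈⋃ →
      let i , x∈Qi = ∈⋃ᶠ⁻ (Q ∘ suc) x∈⋃ in Q# {zero} {suc i} (λ ()) x∈Q x∈Qi)
  V₀ = proj₁ first
  V₀# = proj₁ (proj₂ (proj₂ first))
  others = greedy L w k (Good ∘ suc) (Q ∘ suc) (Q≤ ∘ suc) (λ i≢j → Q# (i≢j ∘ sucᶠ-injective)) (find ∘ suc) (X ∪ V₀)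
    (λ i → Disjoint-∪ʳ {q₁ = X} {V₀} (QX (suc i)) λ x∈Q x∈V → V₀# x∈V (∈∪ʳ {p = X} (∈⋃ᶠ⁺ (Q ∘ suc) i x∈Q)))
    (≤-trans (+-monoˡ-≤ (k * w) (≤-trans (∣p∪q∣≤∣p∣+∣q∣ X V₀) (+-monoʳ-≤ ∣ X ∣ (proj₁ (proj₂ first)))))
             (≤-trans (≤-reflexive (+-assoc ∣ X ∣ w (k * w))) ≤L))
  V : Fin (suc k) → Subset n
  V zero = V₀
  V (suc i) = proj₁ others i
  good : ∀ i → Good i (V i)
  good zero = proj₂ (proj₂ (proj₂ first))
  good (suc i) = proj₁ (proj₂ others) i
  V≤ : ∀ i → ∣ V i ∣ ≤ w
  V≤ zero = proj₁ (proj₂ first)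
  V≤ (suc i) = proj₁ (proj₂ (proj₂ others)) i
  restX : ∀ i → Disjoint (proj₁ others i) (X ∪ V₀)
  restX = proj₁ (proj₂ (proj₂ (proj₂ others)))
  VX : ∀ i → Disjoint (V i) X
  VX zero x∈ x∈X = V₀# x∈ (∈∪ˡ {q = rest} x∈X)
  VX (suc i) x∈ x∈X = restX i x∈ (∈∪ˡ {q = V₀} x∈X)
  V# : ∀ {i j} → i ≢ j → Disjoint (V i) (V j)
  V# {zero} {zero} i≢j = contradiction refl i≢j
  V# {zero} {suc j} _ x∈V₀ x∈ = restX j x∈ (∈∪ʳ {p = X} x∈V₀)
  V# {suc i} {zero} _ x∈ x∈V₀ = restX i x∈ (∈∪ʳ {p = X} x∈V₀)
  V# {suc i} {suc j} i≢j = proj₂ (proj₂ (proj₂ (proj₂ others))) (i≢j ∘ cong suc)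

-- Finite sums and sums over all subsets

module _ {A : Set} where
  ∑ : List A → (A → ℕ) → ℕ
  ∑ [] f = 0
  ∑ (x ∷ xs) f = f x + ∑ xs f

  ∑-mono : ∀ xs {f g : A → ℕ} → (∀ x → f x ≤ g x) → ∑ xs f ≤ ∑ xs g
  ∑-mono [] f≤g = z≤n
  ∑-mono (x ∷ xs) f≤g = +-mono-≤ (f≤g x) (∑-mono xs f≤g)

  ∑-cong : ∀ xs {f g : A → ℕ} → (∀ x → f x ≡ g x) → ∑ xs f ≡ ∑ xs g
  ∑-cong [] f≡g = refl
  ∑-cong (x ∷ xs) f≡g = cong₂ _+_ (f≡g x) (∑-cong xs f≡g)

  ∑-0 : ∀ xs → ∑ xs (λ _ → 0) ≡ 0
  ∑-0 [] = refl
  ∑-0 (x ∷ xs) = ∑-0 xs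

  ∑-+ : ∀ xs (f g : A → ℕ) → ∑ xs (λ x → f x + g x) ≡ ∑ xs f + ∑ xs g
  ∑-+ [] f g = refl
  ∑-+ (x ∷ xs) f g = trans (cong (f x + g x +_) (∑-+ xs f g))
    (solve 4 (λ a b c d → (a :+ b) :+ (c :+ d) := (a :+ c) :+ (b :+ d)) refl (f x) (g x) (∑ xs f) (∑ xs g))
    where open +-*-Solver

  ∑-* : ∀ xs k (f : A → ℕ) → ∑ xs (λ x → k * f x) ≡ k * ∑ xs f
  ∑-* [] k f = sym (*-zeroʳ k)
  ∑-* (x ∷ xs) k f = trans (cong (k * f x +_) (∑-* xs k f)) (sym (*-distribˡ-+ k (f x) _))

  ∑-++ : ∀ xs ys (f : A → ℕ) → ∑ (xs ++ ys) f ≡ ∑ xs f + ∑ ys f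
  ∑-++ [] ys f = refl
  ∑-++ (x ∷ xs) ys f = trans (cong (f x +_) (∑-++ xs ys f)) (sym (+-assoc (f x) _ _))

  ∑-term≤ : ∀ {x} xs (f : A → ℕ) → x ∈ˡ xs → f x ≤ ∑ xs f
  ∑-term≤ (x ∷ xs) f (Any.here refl) = m≤m+n (f x) _
  ∑-term≤ (x ∷ xs) f (Any.there x∈) = ≤-trans (∑-term≤ xs f x∈) (m≤n+m _ (f x))

  any-true : ∀ {x} xs (p : A → Bool) → x ∈ˡ xs → p x ≡ true → any p xs ≡ true
  any-true (x ∷ xs) p (Any.here refl) eq rewrite eq = refl
  any-true (x ∷ xs) p (Any.there x∈) eq with p x
  ... | true = refl
  ... | false = any-true xs p x∈ eq

∑-map : ∀ {A B : Set} (h : A → B) xs (f : B → ℕ) → ∑ (map h xs) f ≡ ∑ xs (f ∘ h)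
∑-map h [] f = refl
∑-map h (x ∷ xs) f = cong (f (h x) +_) (∑-map h xs f)

∑-swap : ∀ {A B : Set} (xs : List A) (ys : List B) (f : A → B → ℕ) →
  ∑ xs (λ x → ∑ ys (f x)) ≡ ∑ ys (λ y → ∑ xs (λ x → f x y))
∑-swap [] ys f = sym (∑-0 ys)
∑-swap (x ∷ xs) ys f = trans (cong (∑ ys (f x) +_) (∑-swap xs ys f)) (sym (∑-+ ys (f x) _))

𝟙 : Bool → ℕ
𝟙 true = 1
𝟙 false = 0

length-filter≡∑ : ∀ {A : Set} {P : A → Set} (P? : ∀ x → Dec (P x)) xs →
  length (filter P? xs) ≡ ∑ xs (λ x → 𝟙 (does (P? x)))
length-filter≡∑ P? [] = refl
length-filter≡∑ P? (x ∷ xs) with does (P? x)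
... | true = cong suc (length-filter≡∑ P? xs)
... | false = length-filter≡∑ P? xs

∑-allFin-suc : ∀ {n} (f : Fin (suc n) → ℕ) → ∑ (allFin (suc n)) f ≡ f zero + ∑ (allFin n) (f ∘ suc)
∑-allFin-suc {n} f = cong (f zero +_)
  (trans (cong (λ xs → ∑ xs f) (sym (map-tabulate id suc))) (∑-map suc (allFin n) f))

∑𝟙≡∣∣ : (p : Subset n) → ∑ (allFin n) (λ x → 𝟙 (lookup p x)) ≡ ∣ p ∣
∑𝟙≡∣∣ [] = refl
∑𝟙≡∣∣ (true ∷ p) = trans (∑-allFin-suc (λ x → 𝟙 (lookup (true ∷ p) x))) (cong suc (∑𝟙≡∣∣ p))
∑𝟙≡∣∣ (false ∷ p) = trans (∑-allFin-suc (λ x → 𝟙 (lookup (false ∷ p) x))) (∑𝟙≡∣∣ p)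

≤∑ : (p : Subset n) (f : Fin n → ℕ) → (∀ x → x ∈ p → 1 ≤ f x) → ∣ p ∣ ≤ ∑ (allFin n) f
≤∑ {n} p f 1≤f = ≤-trans (≤-reflexive (sym (∑𝟙≡∣∣ p))) (∑-mono (allFin n) bound)
  where
  bound : ∀ x → 𝟙 (lookup p x) ≤ f x
  bound x with lookup p x in eq
  ... | true = 1≤f x (lookup⇒[]= x p eq)
  ... | false = z≤n

∑≤ : ∀ (p : Subset n) k (f : Fin n → ℕ) → (∀ x → x ∈ p → f x ≤ k) → (∀ x → x ∉ p → f x ≡ 0) →
  ∑ (allFin n) f ≤ k * ∣ p ∣
∑≤ {n} p k f f≤k f≡0 = ≤-trans (∑-mono (allFin n) bound)
  (≤-reflexive (trans (∑-* (allFin n) k _) (cong (k *_) (∑𝟙≡∣∣ p))))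
  where
  bound : ∀ x → f x ≤ k * 𝟙 (lookup p x)
  bound x with lookup p x in eq
  ... | true = ≤-trans (f≤k x (lookup⇒[]= x p eq)) (≤-reflexive (sym (*-identityʳ k)))
  ... | false = ≤-reflexive (trans (f≡0 x λ x∈p → case trans (sym ([]=⇒lookup x∈p)) eq of λ ()) (sym (*-zeroʳ k)))

∈-allSubsets : (p : Subset n) → p ∈ˡ allSubsets n
∈-allSubsets [] = Any.here refl
∈-allSubsets {suc n} (false ∷ p) = ∈-++⁺ˡ (∈-map⁺ (false ∷_) (∈-allSubsets p))
∈-allSubsets {suc n} (true ∷ p) = ∈-++⁺ʳ (map (false ∷_) (allSubsets n)) (∈-map⁺ (true ∷_) (∈-allSubsets p))

∑-allSubsets-suc : ∀ {n} (f : Subset (suc n) → ℕ) →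
  ∑ (allSubsets (suc n)) f ≡ ∑ (allSubsets n) (λ p → f (false ∷ p)) + ∑ (allSubsets n) (λ p → f (true ∷ p))
∑-allSubsets-suc {n} f = trans (∑-++ (map (false ∷_) (allSubsets n)) _ f)
  (cong₂ _+_ (∑-map (false ∷_) (allSubsets n) f) (∑-map (true ∷_) (allSubsets n) f))

-- p ↦ p ∪ ⁅ u ⁆ is a bijection from the sets avoiding u onto those containing u.
∑-insert : ∀ {n} (u : Fin n) (G : Subset n → ℕ) →
  ∑ (allSubsets n) (λ p → 𝟙 (lookup p u) * G p) ≡ ∑ (allSubsets n) (λ p → 𝟙 (not (lookup p u)) * G (p ∪ ⁅ u ⁆))
∑-insert {suc n} zero G =
  trans (∑-allSubsets-suc (λ p → 𝟙 (lookup p zero) * G p)) (trans (cong₂ _+_ (∑-0 (allSubsets n)) refl)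
  (sym (trans (∑-allSubsets-suc (λ p → 𝟙 (not (lookup p zero)) * G (p ∪ ⁅ zero ⁆)))
    (trans (cong₂ _+_ (∑-cong (allSubsets n) λ p → cong (λ q → 1 * G (true ∷ q)) (∪-identityʳ p)) (∑-0 (allSubsets n)))
           (+-identityʳ _)))))
∑-insert {suc n} (suc u) G =
  trans (∑-allSubsets-suc (λ p → 𝟙 (lookup p (suc u)) * G p))
  (trans (cong₂ _+_ (∑-insert u (λ p → G (false ∷ p)))
                    (trans (∑-insert u (λ p → G (true ∷ p))) (∑-cong (allSubsets n) λ _ → refl)))
  (sym (∑-allSubsets-suc (λ p → 𝟙 (not (lookup p (suc u))) * G (p ∪ ⁅ suc u ⁆)))))

-- Links, shadow and charging

module _ {r n : ℕ} (H : Hypergraph r n) where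
  IsEdge : Subset n → Set
  IsEdge S = edge H S ≡ true

  IsEdge? : ∀ S → Dec (IsEdge S)
  IsEdge? S = edge H S 𝔹.≟ true

  Link : Subset n → Fin n → Set
  Link T u = u ∉ T × IsEdge (T ∪ ⁅ u ⁆)

  Link? : ∀ T u → Dec (Link T u)
  Link? T u = ¬? (u ∈? T) ×-dec IsEdge? (T ∪ ⁅ u ⁆)

  ∣Link∣ : ∀ {T u} → Link T u → ∣ T ∣ ≡ r ∸ 1
  ∣Link∣ {T} (u∉T , E) = cong pred (trans (sym (∣p∪⁅x⁆∣≡1+∣p∣ u∉T)) (uniform H _ E))

  Link⇒inShadow : ∀ {T u} → Link T u → inShadow H T ≡ true
  Link⇒inShadow {T} {u} l@(_ , E) =
    cong₂ _∧_ (trans (isYes≗does (∣ T ∣ ℕ.≟ r ∸ 1)) (does-true⁺ (∣ T ∣ ℕ.≟ r ∸ 1) (∣Link∣ l)))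
      (any-true (allSubsets n) _ (∈-allSubsets (T ∪ ⁅ u ⁆))
        (cong₂ _∧_ E (trans (isYes≗does (T ⊆? T ∪ ⁅ u ⁆)) (does-true⁺ (T ⊆? T ∪ ⁅ u ⁆) (p⊆p∪q ⁅ u ⁆)))))

  Link-─ : ∀ {S u} → IsEdge S → u ∈ S → Link (S - u) u
  Link-─ {S} {u} E u∈S = x∉p-x {p = S} , subst IsEdge (sym ([p-x]∪⁅x⁆≡p u∈S)) E

  -- `c T u` is what the face `T` pays towards the edge `T ∪ ⁅ u ⁆`, in units of `1/K`, so that
  -- fractional payments stay integral. An edge is paid in full when it receives `K`; a face may
  -- spend `t` full payments.
  module Charging (c : Subset n → Fin n → ℕ) (K t : ℕ)
    (capacity : ∀ T → ∣ T ∣ ≡ r ∸ 1 → ∑ (allFin n) (λ u → 𝟙 (does (Link? T u)) * c T u) ≤ K * t) where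

    load : Subset n → ℕ
    load S = ∑ (allFin n) (λ u → 𝟙 (lookup S u) * c (S - u) u)

    Underloaded? : ∀ S → Dec (IsEdge S × load S < K)
    Underloaded? S = IsEdge? S ×-dec (load S <? K)

    private
      pointwise : ∀ S (E? : Dec (IsEdge S)) (U? : Dec (IsEdge S × load S < K)) →
        K * 𝟙 (does E?) ≤ 𝟙 (edge H S) * load S + K * 𝟙 (does U?)
      pointwise S (no _) U? = ≤-trans (≤-reflexive (*-zeroʳ K)) z≤n
      pointwise S (yes E) (yes _) = m≤n+m (K * 1) _
      pointwise S (yes E) (no ¬U) rewrite E = ≤-trans (≤-reflexive (*-identityʳ K))
        (≤-trans (≮⇒≥ λ l<K → ¬U (refl , l<K)) (≤-trans (≤-reflexive (sym (+-identityʳ _))) (m≤m+n _ _)))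

      moved : ∀ T u (l? : Dec (Link T u)) →
        𝟙 (not (lookup T u)) * (𝟙 (edge H (T ∪ ⁅ u ⁆)) * c ((T ∪ ⁅ u ⁆) - u) u) ≤ 𝟙 (does l?) * c T u
      moved T u (yes (u∉T , E)) rewrite p∪⁅x⁆-x≡p u∉T | E with lookup T u
      ... | true = z≤n
      ... | false = ≤-reflexive (*-identityˡ _)
      moved T u (no ¬l) with lookup T u in eq | edge H (T ∪ ⁅ u ⁆)
      ... | true | _ = z≤n
      ... | false | false = z≤n
      ... | false | true = contradiction ((λ u∈T → case trans (sym ([]=⇒lookup u∈T)) eq of λ ()) , refl) ¬l

      received : ∀ T (sh? : Dec (inShadow H T ≡ true)) →
        ∑ (allFin n) (λ u → 𝟙 (does (Link? T u)) * c T u) ≤ K * t * 𝟙 (does sh?)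
      received T (yes sh) = ≤-trans (capacity T size) (≤-reflexive (sym (*-identityʳ (K * t))))
        where
        ∧-true : ∀ {x y} → x ∧ y ≡ true → x ≡ true
        ∧-true {true} _ = refl
        size : ∣ T ∣ ≡ r ∸ 1
        size = does-true⁻ (∣ T ∣ ℕ.≟ r ∸ 1) (trans (sym (isYes≗does (∣ T ∣ ℕ.≟ r ∸ 1))) (∧-true sh))
      received T (no ¬sh) = ≤-trans (≤-reflexive (trans (∑-cong (allFin n) λ u → zeroTerm u (Link? T u)) (∑-0 (allFin n)))) z≤n
        where
        zeroTerm : ∀ u (l? : Dec (Link T u)) → 𝟙 (does l?) * c T u ≡ 0
        zeroTerm u (yes l) = contradiction (Link⇒inShadow l) ¬sh
        zeroTerm u (no _) = refl

      Subs = allSubsets n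
      Vs = allFin n

      -- Double counting: an edge `S` with a vertex `u` is the same as a face `T = S - u` with a
      -- link `u`, so the loads can be collected face by face.
      total : ∑ Subs (λ S → 𝟙 (edge H S) * load S) ≤ K * t * shadowSize H
      total = begin
        ∑ Subs (λ S → 𝟙 (edge H S) * load S)
          ≡⟨ ∑-cong Subs (λ S → trans (sym (∑-* Vs (𝟙 (edge H S)) _)) (∑-cong Vs λ u →
               solve 3 (λ a b c → a :* (b :* c) := b :* (a :* c)) refl (𝟙 (edge H S)) (𝟙 (lookup S u)) (c (S - u) u))) ⟩
        ∑ Subs (λ S → ∑ Vs (λ u → 𝟙 (lookup S u) * (𝟙 (edge H S) * c (S - u) u)))
          ≡⟨ ∑-swap Subs Vs _ ⟩
        ∑ Vs (λ u → ∑ Subs (λ S → 𝟙 (lookup S u) * (𝟙 (edge H S) * c (S - u) u)))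
          ≡⟨ ∑-cong Vs (λ u → ∑-insert u (λ S → 𝟙 (edge H S) * c (S - u) u)) ⟩
        ∑ Vs (λ u → ∑ Subs (λ T → 𝟙 (not (lookup T u)) * (𝟙 (edge H (T ∪ ⁅ u ⁆)) * c ((T ∪ ⁅ u ⁆) - u) u)))
          ≤⟨ ∑-mono Vs (λ u → ∑-mono Subs (λ T → moved T u (Link? T u))) ⟩
        ∑ Vs (λ u → ∑ Subs (λ T → 𝟙 (does (Link? T u)) * c T u))
          ≡⟨ ∑-swap Vs Subs _ ⟩
        ∑ Subs (λ T → ∑ Vs (λ u → 𝟙 (does (Link? T u)) * c T u))
          ≤⟨ ∑-mono Subs (λ T → received T (inShadow H T 𝔹.≟ true)) ⟩
        ∑ Subs (λ T → K * t * 𝟙 (does (inShadow H T 𝔹.≟ true)))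
          ≡⟨ trans (∑-* Subs (K * t) _) (cong (K * t *_) (sym (length-filter≡∑ _ Subs))) ⟩
        K * t * shadowSize H ∎
        where open ≤-Reasoning
              open +-*-Solver

    numEdges≤ : 0 < K → numEdges H ≤ t * shadowSize H + length (filter Underloaded? (allSubsets n))
    numEdges≤ 0<K = *-cancelˡ-≤ K {{ℕ.>-nonZero 0<K}} (begin
      K * numEdges H
        ≡⟨ trans (cong (K *_) (length-filter≡∑ IsEdge? Subs)) (sym (∑-* Subs K _)) ⟩
      ∑ Subs (λ S → K * 𝟙 (does (IsEdge? S)))
        ≤⟨ ∑-mono Subs (λ S → pointwise S (IsEdge? S) (Underloaded? S)) ⟩
      ∑ Subs (λ S → 𝟙 (edge H S) * load S + K * 𝟙 (does (Underloaded? S)))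
        ≡⟨ ∑-+ Subs _ _ ⟩
      ∑ Subs (λ S → 𝟙 (edge H S) * load S) + ∑ Subs (λ S → K * 𝟙 (does (Underloaded? S)))
        ≤⟨ +-mono-≤ total (≤-reflexive (trans (∑-* Subs K _) (cong (K *_) (sym (length-filter≡∑ Underloaded? Subs))))) ⟩
      K * t * shadowSize H + K * length (filter Underloaded? Subs)
        ≡⟨ solve 4 (λ k t a b → k :* t :* a :+ k :* b := k :* (t :* a :+ b)) refl K t (shadowSize H) _ ⟩
      K * (t * shadowSize H + length (filter Underloaded? Subs)) ∎)
      where open ≤-Reasoning
            open +-*-Solver

-- Bounding the length of a list by codes and by classes

Unique⇒lookup-injective : ∀ {A : Set} {xs : List A} → Unique xs → ∀ i j → List.lookup xs i ≡ List.lookup xs j → i ≡ j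
Unique⇒lookup-injective (_ ∷ u) zero zero eq = refl
Unique⇒lookup-injective (x∉ ∷ u) zero (suc j) eq = contradiction eq (All.lookup x∉ (∈-lookup j))
Unique⇒lookup-injective (x∉ ∷ u) (suc i) zero eq = contradiction (sym eq) (All.lookup x∉ (∈-lookup i))
Unique⇒lookup-injective (_ ∷ u) (suc i) (suc j) eq = cong suc (Unique⇒lookup-injective u i j eq)

Unique⇒length≤ : ∀ {A : Set} {m} {xs : List A} → Unique xs → (φ : A → Fin m) →
  (∀ {x y} → x ∈ˡ xs → y ∈ˡ xs → φ x ≡ φ y → x ≡ y) → length xs ≤ m
Unique⇒length≤ {xs = xs} u φ φ-inj = injective⇒≤ {f = φ ∘ List.lookup xs} λ {i} {j} eq →
  Unique⇒lookup-injective u i j (φ-inj (∈-lookup i) (∈-lookup j) eq)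

module _ {X Λ : Set} (_≟Λ_ : (l m : Λ) → Dec (l ≡ m)) (ls : List Λ) (ℓ : X → Λ) (ℓ∈ls : ∀ x → ℓ x ∈ˡ ls) where
  length≤∑classes : ∀ F → length F ≤ ∑ ls (λ l → length (filter (λ x → ℓ x ≟Λ l) F))
  length≤∑classes F = begin
    length F                                         ≡⟨ length≡∑1 F ⟩
    ∑ F (λ _ → 1)                                    ≤⟨ ∑-mono F counted ⟩
    ∑ F (λ x → ∑ ls (λ l → 𝟙 (does (ℓ x ≟Λ l))))     ≡⟨ ∑-swap F ls _ ⟩
    ∑ ls (λ l → ∑ F (λ x → 𝟙 (does (ℓ x ≟Λ l))))     ≡⟨ ∑-cong ls (λ l → sym (length-filter≡∑ (λ x → ℓ x ≟Λ l) F)) ⟩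
    ∑ ls (λ l → length (filter (λ x → ℓ x ≟Λ l) F))  ∎
    where
    open ≤-Reasoning
    length≡∑1 : ∀ F → length F ≡ ∑ F (λ _ → 1)
    length≡∑1 [] = refl
    length≡∑1 (_ ∷ F) = cong suc (length≡∑1 F)
    counted : ∀ x → 1 ≤ ∑ ls (λ l → 𝟙 (does (ℓ x ≟Λ l)))
    counted x = ≤-trans (≤-reflexive (cong 𝟙 (sym (does-true⁺ (ℓ x ≟Λ ℓ x) refl))))
                        (∑-term≤ ls (λ l → 𝟙 (does (ℓ x ≟Λ l))) (ℓ∈ls x))

  length≤labels*class : ∀ F M → (∀ l → length (filter (λ x → ℓ x ≟Λ l) F) ≤ M) → length F ≤ length ls * M
  length≤labels*class F M class≤ = ≤-trans (length≤∑classes F) (sum≤ ls)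
    where
    sum≤ : ∀ ls → ∑ ls (λ l → length (filter (λ x → ℓ x ≟Λ l) F)) ≤ length ls * M
    sum≤ [] = z≤n
    sum≤ (l ∷ ls) = +-mono-≤ (class≤ l) (sum≤ ls)

-- Closed families and functional dependencies

another : ∀ {x} (p : Subset n) → x ∈ p → ∣ p ∣ ≢ 1 → ∃ λ y → y ∈ p × y ≢ x
another {n} {x} p x∈p ∣p∣≢1 with nonempty? (p - x)
... | yes (y , y∈) = y , p-x⊆p {p = p} y∈ , λ { refl → x∉p-x {p = p} y∈ }
... | no empty = contradiction
  (trans (sym (∣p-x∣+1≡∣p∣ x∈p)) (cong suc (trans (cong ∣_∣ (Empty-unique empty)) (∣⊥∣≡0 n)))) ∣p∣≢1

-- In a closure system on the coordinates where no r ∸ 2 of them generate the rest, all P satisfying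
-- this condition are closed, for N = the coordinates generated by all the others.
Admissible : ∀ {r} → Subset r → Subset r → Set
Admissible N P = ∣ N ─ P ∣ ≢ 1

-- A label stands for a dependency `P → q`; the index in `Fin L` pins down the value at `q`. The
-- number of labels does not depend on `n`.
Label : ℕ → ℕ → Set
Label r L = Subset r × Fin r × Fin L

labels : ∀ r L → List (Label r L)
labels r L = cartesianProduct (allSubsets r) (cartesianProduct (allFin r) (allFin L))

∈-labels : ∀ {r L} (l : Label r L) → l ∈ˡ labels r L
∈-labels (P , q , i) = ∈-cartesianProduct⁺ (∈-allSubsets P) (∈-cartesianProduct⁺ (∈-allFin q) (∈-allFin i))

_≟ₗ_ : ∀ {r L} (l m : Label r L) → Dec (l ≡ m)
_≟ₗ_ = ×-≡-dec (Vec-≡-dec 𝔹._≟_) (×-≡-dec _≟ᶠ_ _≟ᶠ_)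

module Families {X : Set} {r n : ℕ} (co : X → Fin r → Fin n) where

  Agree : Subset r → X → X → Set
  Agree P x y = ∀ i → i ∈ P → co x i ≡ co y i

  Agree? : ∀ P x y → Dec (Agree P x y)
  Agree? P x y = allFin? λ i → (i ∈? P) →-dec (co x i ≟ᶠ co y i)

  Avoids : Subset r → Subset n → X → Set
  Avoids P U f = ∀ i → i ∉ P → co f i ∉ U

  -- Avoiding every small `U` does the work of a large sunflower whose kernel is `e` on `P`: petals
  -- can be picked one by one, and a failure supplies a single small set that meets them all.
  Closed : ℕ → Subset r → List X → Set
  Closed L N F = ∀ {e} → e ∈ˡ F → ∀ P → Admissible N P → ∀ U → ∣ U ∣ ≤ L →
    ∃ λ f → f ∈ˡ F × Agree P e f × Avoids P U f

  -- Quantifying over all nonempty subfamilies makes the property hereditary, as is needed when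
  -- groups are removed and classes are formed.
  NoClosed : ℕ → Subset r → List X → Set
  NoClosed L N F = ∀ F′ {e} → (∀ {x} → x ∈ˡ F′ → x ∈ˡ F) → e ∈ˡ F′ → ¬ Closed L N F′

  Determines : List X → Subset r → Fin r → Set
  Determines F P q = ∀ {x y} → x ∈ˡ F → y ∈ˡ F → Agree P x y → co x q ≡ co y q

  Determines? : ∀ F P q → Dec (Determines F P q)
  Determines? F P q = map′ (λ all x∈ y∈ → All.lookup (All.lookup all x∈) y∈)
    (λ det → All.tabulate λ x∈ → All.tabulate λ y∈ → det x∈ y∈)
    (All.all? (λ x → All.all? (λ y → Agree? P x y →-dec (co x q ≟ᶠ co y q)) F) F)

  module _ (L : ℕ) (N : Subset r) where
    Hit : Subset r → Subset n → X → Set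
    Hit P U f = ∃ λ i → i ∉ P × co f i ∈ U

    Hit? : ∀ P U f → Dec (Hit P U f)
    Hit? P U f = anyFin? λ i → ¬? (i ∈? P) ×-dec (co f i ∈? U)

    NonKernel : List X → X → Set
    NonKernel F e = ∃ λ P → Admissible N P × ∃ λ U → ∣ U ∣ ≤ L × All (λ f → Agree P e f → Hit P U f) F

    NonKernel? : ∀ F e → Dec (NonKernel F e)
    NonKernel? F e = anySubset? λ P → ¬? (∣ N ─ P ∣ ℕ.≟ 1) ×-dec
      anySubset? λ U → (∣ U ∣ ≤? L) ×-dec All.all? (λ f → Agree? P e f →-dec Hit? P U f) F

    ¬NonKernel⇒Closed : ∀ F → ¬ Any (NonKernel F) F → Closed L N F
    ¬NonKernel⇒Closed F none {e} e∈F P adm U ∣U∣≤L with Any.any? (λ f → Agree? P e f ×-dec ¬? (Hit? P U f)) F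
    ... | yes found = let f , f∈F , agree , ¬hit = find found in f , f∈F , agree , λ i i∉P i∈U → ¬hit (i , i∉P , i∈U)
    ... | no none′ = contradiction
      (lose e∈F (P , adm , U , ∣U∣≤L , All.tabulate λ {f} f∈F agree →
        decidable-stable (Hit? P U f) λ ¬hit → none′ (lose f∈F (agree , ¬hit)))) none

    WellLabelled : List X → (X → Label r L) → X → Set
    WellLabelled F ℓ x = let P , q , _ = ℓ x in Admissible N P × q ∉ P ×
      (∀ {y} → y ∈ˡ F → ℓ y ≡ ℓ x → Agree P x y → co x q ≡ co y q)

    -- If P is not a kernel at e, then U meets every member agreeing with e on P; such a member f is
    -- labelled with P, a coordinate q where it meets U and the rank of its value there in U, and the
    -- whole group is removed.
    labelling : Label r L → ∀ m F → length F ≤ m → NoClosed L N F →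
      Σ (X → Label r L) λ ℓ → ∀ {x} → x ∈ˡ F → WellLabelled F ℓ x
    labelling l₀ m [] _ _ = (λ _ → l₀) , λ ()
    labelling l₀ (suc m) F@(e₀ ∷ F₀) (s≤s len) noClosed with Any.any? (NonKernel? F) F
    ... | no none = contradiction (λ {e} → ¬NonKernel⇒Closed F none {e}) (noClosed F id (Any.here refl))
    ... | yes bad with find bad
    ... | e , e∈F , P , adm , U , ∣U∣≤L , hits = ℓ , λ {x} x∈F → well x (Agree? P e x) (Hit? P U x) x∈F
      where
      F₁ : List X
      F₁ = filter (λ x → ¬? (Agree? P e x)) F
      shorter : length F₁ ≤ m
      shorter = ≤-pred (≤-trans (filter-notAll (λ x → ¬? (Agree? P e x)) F (lose e∈F λ ¬agree → ¬agree λ i _ → refl)) (s≤s len))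
      rec = labelling l₀ m F₁ shorter λ F′ F′⊆ → noClosed F′ (λ x∈ → proj₁ (∈-filter⁻ (λ x → ¬? (Agree? P e x)) {xs = F} (F′⊆ x∈)))
      ℓ₁ : X → Label r L
      ℓ₁ = proj₁ rec
      step : ∀ x → Dec (Agree P e x) → Dec (Hit P U x) → Label r L
      step x (no _) _ = ℓ₁ x
      step x (yes _) (yes (i , _ , i∈U)) = P , i , inject≤ (rank U i∈U) ∣U∣≤L
      -- A default: by `hits`, no member of `F` falls under this clause.
      step x (yes _) (no _) = l₀
      ℓ : X → Label r L
      ℓ x = step x (Agree? P e x) (Hit? P U x)
      hit : ∀ {x} → x ∈ˡ F → Agree P e x → Hit P U x
      hit x∈F = All.lookup hits x∈F
      det : ∀ x y a? h? b? k? → x ∈ˡ F → y ∈ˡ F → step y b? k? ≡ step x a? h? →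
        let P′ , q , _ = step x a? h? in Agree P′ x y → co x q ≡ co y q
      det x y (yes a) (no ¬h) b? k? x∈ y∈ = contradiction (hit x∈ a) ¬h
      det x y (yes a) (yes _) (yes b) (no ¬k) x∈ y∈ = contradiction (hit y∈ b) ¬k
      det x y (yes a) (yes (i , _ , i∈U)) (yes b) (yes (j , _ , j∈U)) x∈ y∈ eq _ with cong (proj₁ ∘ proj₂) eq
      ... | refl = sym (rank-injective U j∈U i∈U (inject≤-injective ∣U∣≤L ∣U∣≤L _ _ (cong (proj₂ ∘ proj₂) eq)))
      -- One class may mix members of the removed group with others, but a `y` that agrees on `P`
      -- with a member of the group belongs to the group.
      det x y (yes a) (yes _) (no ¬b) k? x∈ y∈ eq agree = contradiction (λ i i∈P → trans (a i i∈P) (agree i i∈P)) ¬b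
      det x y (no ¬a) h? (yes b) (no ¬k) x∈ y∈ = contradiction (hit y∈ b) ¬k
      det x y (no ¬a) h? (yes b) (yes _) x∈ y∈ eq agree =
        contradiction (λ i i∈P → trans (b i i∈P) (sym (agree i (subst (i ∈_) (cong proj₁ eq) i∈P)))) ¬a
      det x y (no ¬a) h? (no ¬b) k? x∈ y∈ eq =
        proj₂ (proj₂ (proj₂ rec (∈-filter⁺ (λ x → ¬? (Agree? P e x)) x∈ ¬a))) (∈-filter⁺ (λ x → ¬? (Agree? P e x)) y∈ ¬b) eq
      well : ∀ x a? h? → x ∈ˡ F → let P′ , q , _ = step x a? h? in Admissible N P′ × q ∉ P′ ×
        (∀ {y} → y ∈ˡ F → ℓ y ≡ step x a? h? → Agree P′ x y → co x q ≡ co y q)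
      well x (yes a) (no ¬h) x∈ = contradiction (hit x∈ a) ¬h
      well x a@(yes _) h@(yes (i , i∉P , _)) x∈ = adm , i∉P , λ {y} → det x y a h (Agree? P e y) (Hit? P U y) x∈
      well x a@(no ¬a) h x∈ =
        let adm′ , q∉ , _ = proj₂ rec (∈-filter⁺ (λ x → ¬? (Agree? P e x)) x∈ ¬a)
        in adm′ , q∉ , λ {y} → det x y a h (Agree? P e y) (Hit? P U y) x∈

  HasDependency : List X → Subset r → Set
  HasDependency G N = ∃ λ P → ∃ λ q → Admissible N P × q ∉ P × Determines G P q

  module _ (L : ℕ) (l₀ : Label r L) where
    -- A dependency is inherited by subfamilies, so the classes can be refined for one `N` after
    -- another. All `N` are treated in advance because the one that will be used depends on the
    -- final family `G`.
    length≤-byDependencies : ∀ Ns F M → Unique F → (∀ {N} → N ∈ˡ Ns → NoClosed L N F) →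
      (∀ G {x} → Unique G → (∀ {x} → x ∈ˡ G → x ∈ˡ F) → x ∈ˡ G → (∀ {N} → N ∈ˡ Ns → HasDependency G N) → length G ≤ M) →
      length F ≤ length (labels r L) ^ length Ns * M
    length≤-byDependencies [] [] M uF _ _ = z≤n
    length≤-byDependencies [] F@(_ ∷ _) M uF _ G≤M =
      ≤-trans (G≤M F uF id (Any.here refl) λ ()) (≤-reflexive (sym (*-identityˡ M)))
    length≤-byDependencies (N ∷ Ns) F M uF noClosed G≤M =
      ≤-trans (length≤labels*class _≟ₗ_ (labels r L) ℓ (∈-labels ∘ ℓ) F (length (labels r L) ^ length Ns * M) class≤)
              (≤-reflexive (sym (*-assoc (length (labels r L)) (length (labels r L) ^ length Ns) M)))
      where
      lab = labelling L N l₀ (length F) F ≤-refl (noClosed (Any.here refl))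
      ℓ = proj₁ lab
      class≤ : ∀ l → length (filter (λ x → ℓ x ≟ₗ l) F) ≤ length (labels r L) ^ length Ns * M
      class≤ l@(P , q , _) = length≤-byDependencies Ns Fₗ M (Unique.filter⁺ (λ x → ℓ x ≟ₗ l) uF)
        (λ N∈ F′ F′⊆ → noClosed (Any.there N∈) F′ (proj₁ ∘ inClass ∘ F′⊆)) G≤
        where
        Fₗ = filter (λ x → ℓ x ≟ₗ l) F
        inClass : ∀ {x} → x ∈ˡ Fₗ → x ∈ˡ F × ℓ x ≡ l
        inClass = ∈-filter⁻ (λ x → ℓ x ≟ₗ l) {xs = F}
        G≤ : ∀ G {x} → Unique G → (∀ {x} → x ∈ˡ G → x ∈ˡ Fₗ) → x ∈ˡ G → (∀ {N} → N ∈ˡ Ns → HasDependency G N) → length G ≤ M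
        G≤ G {x} uG G⊆ x∈G deps = G≤M G uG (proj₁ ∘ inClass ∘ G⊆) x∈G λ
          { (Any.here refl) → dep ; (Any.there N∈) → deps N∈ }
          where
          fromLabel : ∀ {y} → y ∈ˡ Fₗ → Admissible N P × q ∉ P × (∀ {z} → z ∈ˡ Fₗ → Agree P y z → co y q ≡ co z q)
          fromLabel {y} y∈ with inClass y∈
          ... | y∈F , refl = let adm , q∉P , det = proj₂ lab y∈F
                             in adm , q∉P , λ z∈ → let z∈F , eq = inClass z∈ in det z∈F eq
          dep : HasDependency G N
          dep = let adm , q∉P , _ = fromLabel (G⊆ x∈G)
                in P , q , adm , q∉P , λ y∈ z∈ → proj₂ (proj₂ (fromLabel (G⊆ y∈))) (G⊆ z∈)

module _ {X : Set} {r n : ℕ} (co : X → Fin (2 + r) → Fin n) (co-ext : ∀ {x y} → (∀ i → co x i ≡ co y i) → x ≡ y) where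
  open Families co

  -- Apply the dependencies to N = the coordinates determined by all the others: the dependency P → q
  -- so obtained misses a second q′ ∈ N, so the coordinates other than q and q′ determine everything.
  dependency⇒length≤ : ∀ G → Unique G → ∀ N → (∀ {q} → Determines G (∁ ⁅ q ⁆) q → q ∈ N) →
    (∀ {q} → q ∈ N → Determines G (∁ ⁅ q ⁆) q) → HasDependency G N → length G ≤ n ^ r
  dependency⇒length≤ G uG N N⁺ N⁻ (P , q , adm , q∉P , det) = Unique⇒length≤ uG φ φ-injective
    where
    q∈N : q ∈ N
    q∈N = N⁺ λ x∈ y∈ agree → det x∈ y∈ λ i i∈P →
      agree i (x∉p⇒x∈∁p λ i∈q → q∉P (subst (_∈ P) (x∈⁅y⁆⇒x≡y q i∈q) i∈P))
    second = another (N ─ P) (x∈p∧x∉q⇒x∈p─q q∈N q∉P) adm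
    q′ = proj₁ second
    q′∈N : q′ ∈ N
    q′∈N = proj₁ (x∈p─q⁻ N P (proj₁ (proj₂ second)))
    q′∉P : q′ ∉ P
    q′∉P = proj₂ (x∈p─q⁻ N P (proj₁ (proj₂ second)))
    q≢q′ : q ≢ q′
    q≢q′ = proj₂ (proj₂ second) ∘ sym
    keep : Fin r → Fin (2 + r)
    keep k = punchIn q (punchIn (punchOut q≢q′) k)
    φ : X → Fin (n ^ r)
    φ x = funToFin (co x ∘ keep)
    kept : ∀ i → i ≢ q → i ≢ q′ → ∃ λ k → keep k ≡ i
    kept i i≢q i≢q′ = punchOut {i = punchOut q≢q′} {j = punchOut q≢i} ne ,
      trans (cong (punchIn q) (punchIn-punchOut ne)) (punchIn-punchOut q≢i)
      where
      q≢i : q ≢ i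
      q≢i = i≢q ∘ sym
      ne : punchOut q≢q′ ≢ punchOut q≢i
      ne eq = i≢q′ (trans (sym (punchIn-punchOut q≢i)) (trans (cong (punchIn q) (sym eq)) (punchIn-punchOut q≢q′)))
    φ-injective : ∀ {x y} → x ∈ˡ G → y ∈ˡ G → φ x ≡ φ y → x ≡ y
    φ-injective {x} {y} x∈ y∈ eq = co-ext all
      where
      off : ∀ i → i ≢ q → i ≢ q′ → co x i ≡ co y i
      off i i≢q i≢q′ with kept i i≢q i≢q′
      ... | k , refl = trans (sym (finToFun-funToFin (co x ∘ keep) k))
        (trans (cong (λ c → finToFun c k) eq) (finToFun-funToFin (co y ∘ keep) k))
      -- The value at `q` is recovered first, from `P`, which contains neither missing coordinate;
      -- then all coordinates but `q′` are known, and they determine the last one.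
      at-q : co x q ≡ co y q
      at-q = det x∈ y∈ λ i i∈P → off i (λ { refl → q∉P i∈P }) (λ { refl → q′∉P i∈P })
      off-q′ : ∀ i → i ≢ q′ → co x i ≡ co y i
      off-q′ i i≢q′ with i ≟ᶠ q
      ... | yes refl = at-q
      ... | no i≢q = off i i≢q i≢q′
      all : ∀ i → co x i ≡ co y i
      all i with i ≟ᶠ q′
      ... | yes refl = N⁻ q′∈N x∈ y∈ λ j j∈ →
              off-q′ j λ { refl → x∈∁p⇒x∉p j∈ (x∈⁅x⁆ q′) }
      ... | no i≢q′ = off-q′ i i≢q′

  dependencies⇒length≤ : ∀ G → Unique G → (∀ N → HasDependency G N) → length G ≤ n ^ r
  dependencies⇒length≤ G uG deps = dependency⇒length≤ G uG N (∈⟦⟧⁺ N?) (∈⟦⟧⁻ N?) (deps N)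
    where
    N? : ∀ q → Dec (Determines G (∁ ⁅ q ⁆) q)
    N? q = Determines? G (∁ ⁅ q ⁆) q
    N : Subset (2 + r)
    N = ⟦ N? ⟧

abstract
  familyConstant : ℕ → ℕ → ℕ
  familyConstant L r = length (labels (2 + r) (suc L)) ^ length (allSubsets (2 + r))

  noClosed⇒length≤ : ∀ {X : Set} {r n} L (co : X → Fin (2 + r) → Fin n) → (∀ {x y} → (∀ i → co x i ≡ co y i) → x ≡ y) →
    ∀ F → Unique F → (∀ N → Families.NoClosed co (suc L) N F) → length F ≤ familyConstant L r * n ^ r
  noClosed⇒length≤ {r = r} {n} L co co-ext F uF noClosed =
    -- The successor guarantees that a default label exists.
    Families.length≤-byDependencies co (suc L) (⊥ , zero , zero) (allSubsets (2 + r)) F (n ^ r) uF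
      (λ {N} _ → noClosed N) λ G uG _ _ deps → dependencies⇒length≤ co co-ext G uG (λ N → deps (∈-allSubsets N))

-- Building a bush from kernels

listing : ∀ {k} (p : Subset n) → ∣ p ∣ ≡ k → Σ (Fin k → Fin n) λ g →
  (∀ {i j} → g i ≡ g j → i ≡ j) × (∀ i → g i ∈ p) × (∀ {x} → x ∈ p → ∃ λ i → g i ≡ x)
listing p refl = enum p , enum-injective p , enum-∈ p , λ x∈p → rank p x∈p , enum-rank p x∈p

setOf-++ : (xs ys : List (Fin n)) → setOf (xs ++ ys) ≡ setOf xs ∪ setOf ys
setOf-++ [] ys = sym (∪-identityˡ (setOf ys))
setOf-++ (x ∷ xs) ys = trans (cong (⁅ x ⁆ ∪_) (setOf-++ xs ys)) (sym (∪-assoc ⁅ x ⁆ (setOf xs) (setOf ys)))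

∈-setOf⁻ : ∀ {x} (xs : List (Fin n)) → x ∈ setOf xs → x ∈ˡ xs
∈-setOf⁻ [] x∈ = contradiction x∈ ∉⊥
∈-setOf⁻ (y ∷ xs) x∈ with x∈p∪q⁻ ⁅ y ⁆ (setOf xs) x∈
... | inj₁ x∈y = Any.here (x∈⁅y⁆⇒x≡y y x∈y)
... | inj₂ x∈xs = Any.there (∈-setOf⁻ xs x∈xs)

∈-setOf⁺ : ∀ {x} (xs : List (Fin n)) → x ∈ˡ xs → x ∈ setOf xs
∈-setOf⁺ (y ∷ xs) (Any.here refl) = ∈∪ˡ {q = setOf xs} (x∈⁅x⁆ y)
∈-setOf⁺ (y ∷ xs) (Any.there x∈) = ∈∪ʳ {p = ⁅ y ⁆} (∈-setOf⁺ xs x∈)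

setOf-listing : ∀ {B : Set} {k} (f : B → Fin n) (c : Fin k → B) (p : Subset n) →
  (∀ i → f (c i) ∈ p) → (∀ {x} → x ∈ p → ∃ λ i → f (c i) ≡ x) → setOf (map f (map c (allFin k))) ≡ p
setOf-listing {k = k} f c p ∈p onto = trans (cong setOf (sym (map-∘ {g = f} {f = c} (allFin k)))) (⊆-antisym
  (λ x∈ → let i , _ , eq = ∈-map⁻ (f ∘ c) (∈-setOf⁻ (map (f ∘ c) (allFin k)) x∈) in subst (_∈ p) (sym eq) (∈p i))
  (λ x∈p → let i , eq = onto x∈p in
    ∈-setOf⁺ (map (f ∘ c) (allFin k)) (subst (_∈ˡ map (f ∘ c) (allFin k)) eq (∈-map⁺ (f ∘ c) (∈-allFin i)))))

-- `width` bounds one branch, a stem with its `h` leaves. `few` bounds what the stem of a new branch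
-- has to avoid: `A`, an initial set of at most `3 * r` vertices, and the other branches or their
-- cores. Beyond `few`, `L` has room for picking the leaves of that branch.
module Sizes (r s h : ℕ) where
  width few L₀ L : ℕ
  width = (1 + h) * r
  few = r + (3 * r + s * width)
  L₀ = few + s * width + width
  L = suc L₀

module Bushes {r n : ℕ} (H : Hypergraph r n) (a b s h : ℕ) (a+b≡r : a + b ≡ r) where

  -- A stem and its leaves are boxed in a set `V`, so that different branches are kept apart simply
  -- by disjoint boxes.
  record Branch (A V : Subset n) : Set where
    field
      stem : Subset n
      leaf : Fin h → Subset n
      ∣stem∣ : ∣ stem ∣ ≡ b
      ∣leaf∣ : ∀ j → ∣ leaf j ∣ ≡ a
      stem⊆V : stem ⊆ V
      leaf⊆V : ∀ j → leaf j ⊆ V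
      stem#leaf : ∀ j → Disjoint stem (leaf j)
      leaf#leaf : ∀ {i j} → i ≢ j → Disjoint (leaf i) (leaf j)
      trunk-edge : IsEdge H (A ∪ stem)
      leaf-edge : ∀ j → IsEdge H (stem ∪ leaf j)

  branches⇒bush : ∀ {A} → ∣ A ∣ ≡ a → (V : Fin s → Subset n) → (∀ i → Branch A (V i)) → (∀ i → Disjoint (V i) A) →
    (∀ {i j} → i ≢ j → Disjoint (V i) (V j)) → ContainsBush H a b s h
  branches⇒bush {A} ∣A∣≡a V br V#A V#V = f , f-injective , trunk , leaves
    where
    module Br i = Branch (br i)
    listA = listing A ∣A∣≡a
    listB = λ i → listing (Br.stem i) (Br.∣stem∣ i)
    listL = λ i j → listing (Br.leaf i j) (Br.∣leaf∣ i j)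
    f : BushV a b s h → Fin n
    f (inj₁ k) = proj₁ listA k
    f (inj₂ (inj₁ (i , k))) = proj₁ (listB i) k
    f (inj₂ (inj₂ (i , j , k))) = proj₁ (listL i j) k
    ∈A : ∀ k → f (inj₁ k) ∈ A
    ∈A = proj₁ (proj₂ (proj₂ listA))
    ∈B : ∀ i k → f (inj₂ (inj₁ (i , k))) ∈ Br.stem i
    ∈B i = proj₁ (proj₂ (proj₂ (listB i)))
    ∈L : ∀ i j k → f (inj₂ (inj₂ (i , j , k))) ∈ Br.leaf i j
    ∈L i j = proj₁ (proj₂ (proj₂ (listL i j)))
    clash : ∀ {x y p q} → Disjoint p q → x ≡ y → x ∈ p → y ∈ q → {C : Set} → C
    clash d refl x∈p y∈q = contradiction y∈q (d x∈p)
    stem#leaf : ∀ i i′ j → Disjoint (Br.stem i) (Br.leaf i′ j)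
    stem#leaf i i′ j with i ≟ᶠ i′
    ... | yes refl = Br.stem#leaf i j
    ... | no i≢i′ = λ x∈ x∈′ → V#V i≢i′ (Br.stem⊆V i x∈) (Br.leaf⊆V i′ j x∈′)
    f-injective : Injective _≡_ _≡_ f
    f-injective {inj₁ k} {inj₁ k′} eq = cong inj₁ (proj₁ (proj₂ listA) eq)
    f-injective {inj₁ k} {inj₂ (inj₁ (i , k′))} eq = clash (V#A i) (sym eq) (Br.stem⊆V i (∈B i k′)) (∈A k)
    f-injective {inj₁ k} {inj₂ (inj₂ (i , j , k′))} eq = clash (V#A i) (sym eq) (Br.leaf⊆V i j (∈L i j k′)) (∈A k)
    f-injective {inj₂ (inj₁ (i , k))} {inj₁ k′} eq = clash (V#A i) eq (Br.stem⊆V i (∈B i k)) (∈A k′)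
    f-injective {inj₂ (inj₂ (i , j , k))} {inj₁ k′} eq = clash (V#A i) eq (Br.leaf⊆V i j (∈L i j k)) (∈A k′)
    f-injective {inj₂ (inj₁ (i , k))} {inj₂ (inj₁ (i′ , k′))} eq with i ≟ᶠ i′
    ... | yes refl = cong (λ k → inj₂ (inj₁ (i , k))) (proj₁ (proj₂ (listB i)) eq)
    ... | no i≢i′ = clash (V#V i≢i′) eq (Br.stem⊆V i (∈B i k)) (Br.stem⊆V i′ (∈B i′ k′))
    f-injective {inj₂ (inj₁ (i , k))} {inj₂ (inj₂ (i′ , j , k′))} eq = clash (stem#leaf i i′ j) eq (∈B i k) (∈L i′ j k′)
    f-injective {inj₂ (inj₂ (i′ , j , k′))} {inj₂ (inj₁ (i , k))} eq = clash (stem#leaf i i′ j) (sym eq) (∈B i k) (∈L i′ j k′)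
    f-injective {inj₂ (inj₂ (i , j , k))} {inj₂ (inj₂ (i′ , j′ , k′))} eq with i ≟ᶠ i′
    ... | no i≢i′ = clash (V#V i≢i′) eq (Br.leaf⊆V i j (∈L i j k)) (Br.leaf⊆V i′ j′ (∈L i′ j′ k′))
    ... | yes refl with j ≟ᶠ j′
    ...   | yes refl = cong (λ k → inj₂ (inj₂ (i , j , k))) (proj₁ (proj₂ (listL i j)) eq)
    ...   | no j≢j′ = clash (Br.leaf#leaf i j≢j′) eq (∈L i j k) (∈L i j′ k′)
    setA : setOf (map f vA) ≡ A
    setA = setOf-listing f inj₁ A ∈A (proj₂ (proj₂ (proj₂ listA)))
    setB : ∀ i → setOf (map f (vB i)) ≡ Br.stem i
    setB i = setOf-listing f (λ k → inj₂ (inj₁ (i , k))) (Br.stem i) (∈B i) (proj₂ (proj₂ (proj₂ (listB i))))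
    setL : ∀ i j → setOf (map f (vAij i j)) ≡ Br.leaf i j
    setL i j = setOf-listing f (λ k → inj₂ (inj₂ (i , j , k))) (Br.leaf i j) (∈L i j) (proj₂ (proj₂ (proj₂ (listL i j))))
    union : ∀ {p q} xs ys → setOf (map f xs) ≡ p → setOf (map f ys) ≡ q → p ∪ q ≡ setOf (map f (xs ++ ys))
    union xs ys refl refl = sym (trans (cong setOf (map-++ f xs ys)) (setOf-++ (map f xs) (map f ys)))
    trunk : ∀ i → IsEdge H (setOf (map f (vA ++ vB i)))
    trunk i = subst (IsEdge H) (union vA (vB i) setA (setB i)) (Br.trunk-edge i)
    leaves : ∀ i j → IsEdge H (setOf (map f (vB i ++ vAij i j)))
    leaves i j = subst (IsEdge H) (union (vB i) (vAij i j) (setB i) (setL i j)) (Br.leaf-edge i j)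

  open Sizes r s h public

  Kernel : Subset n → Set
  Kernel K = ∀ U → ∣ U ∣ ≤ L → ∃ λ f → IsEdge H f × K ⊆ f × Disjoint (f ─ K) U

  abstract
    Kernel? : ∀ K → Dec (Kernel K)
    Kernel? K = allSubset? λ U → (∣ U ∣ ≤? L) →-dec
      anySubset? λ f → IsEdge? H f ×-dec (K ⊆? f) ×-dec Disjoint? (f ─ K) U

  -- The condition for `A` to receive a further branch through the prescribed vertices `Q ─ A`: the
  -- new stem is `f ─ A`, and its being a kernel supplies the leaves.
  Extendable : Subset n → Subset n → Set
  Extendable A Q = ∀ U → ∣ U ∣ ≤ L → ∃ λ f → IsEdge H f × Q ⊆ f × Disjoint (f ─ Q) U × Kernel (f ─ A)

  abstract
    Extendable? : ∀ A Q → Dec (Extendable A Q)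
    Extendable? A Q = allSubset? λ U → (∣ U ∣ ≤? L) →-dec
      anySubset? λ f → IsEdge? H f ×-dec (Q ⊆? f) ×-dec Disjoint? (f ─ Q) U ×-dec Kernel? (f ─ A)

  few≤L : few ≤ L
  few≤L = ≤-trans (m≤m+n few (s * width)) (≤-trans (m≤m+n _ width) (n≤1+n _))

  kernel⇒branch : ∀ {A B} X → ∣ X ∣ ≤ few → Disjoint B X → ∣ B ∣ ≡ b → IsEdge H (A ∪ B) → Kernel B →
    Σ (Subset n) λ V → ∣ V ∣ ≤ width × Disjoint V X × Branch A V
  kernel⇒branch {A} {B} X ∣X∣≤ B#X ∣B∣≡b E ker = V , V≤ , V#X , record
    { stem = B ; leaf = leaf ; ∣stem∣ = ∣B∣≡b ; ∣leaf∣ = λ j → proj₁ (good j)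
    ; stem⊆V = ∈∪ˡ {q = ⋃ᶠ leaf} ; leaf⊆V = λ j x∈ → ∈∪ʳ {p = B} (∈⋃ᶠ⁺ leaf j x∈)
    ; stem#leaf = λ j x∈B x∈l → leaf#XB j x∈l (∈∪ʳ {p = X} x∈B)
    ; leaf#leaf = proj₂ (proj₂ (proj₂ (proj₂ chosen)))
    ; trunk-edge = E ; leaf-edge = λ j → proj₂ (good j) }
    where
    b≤r : b ≤ r
    b≤r = ≤-trans (m≤n+m b a) (≤-reflexive a+b≡r)
    choose : ∀ (j : Fin h) Y → ∣ Y ∣ ≤ L → Disjoint ⊥ Y →
      Σ (Subset n) λ V → ∣ V ∣ ≤ r × Disjoint V Y × (∣ V ∣ ≡ a × IsEdge H (B ∪ V))
    choose _ Y ∣Y∣≤ _ with ker Y ∣Y∣≤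
    ... | f , Ef , B⊆f , f#Y = f ─ B , ≤-trans (∣p─q∣≤∣p∣ f B) (≤-reflexive (uniform H f Ef)) , f#Y ,
      +-cancelˡ-≡ b _ _ (trans (cong (_+ ∣ f ─ B ∣) (sym ∣B∣≡b))
        (trans (∣p∣+∣q─p∣≡∣q∣ B⊆f) (trans (uniform H f Ef) (trans (sym a+b≡r) (+-comm a b))))) ,
      subst (IsEdge H) (sym (p∪[q─p]≡q B⊆f)) Ef
    chosen = greedy L r h (λ _ V → ∣ V ∣ ≡ a × IsEdge H (B ∪ V)) (λ _ → ⊥) (λ _ → ≤-trans (≤-reflexive (∣⊥∣≡0 n)) z≤n)
      (λ _ x∈ → contradiction x∈ ∉⊥) choose (X ∪ B) (λ _ x∈ → contradiction x∈ ∉⊥) (begin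
        ∣ X ∪ B ∣ + h * r              ≤⟨ +-monoˡ-≤ (h * r) (∣p∪q∣≤∣p∣+∣q∣ X B) ⟩
        ∣ X ∣ + ∣ B ∣ + h * r          ≤⟨ +-monoˡ-≤ (h * r) (+-mono-≤ ∣X∣≤ (≤-trans (≤-reflexive ∣B∣≡b) b≤r)) ⟩
        few + r + h * r                ≡⟨ +-assoc few r (h * r) ⟩
        few + width                    ≤⟨ +-monoˡ-≤ width (m≤m+n few (s * width)) ⟩
        few + s * width + width        ≤⟨ n≤1+n _ ⟩
        L                              ≤⟨ m≤m+n L r ⟩
        L + r                          ∎)
      where open ≤-Reasoning
    leaf = proj₁ chosen
    good = proj₁ (proj₂ chosen)
    leaf#XB : ∀ j → Disjoint (leaf j) (X ∪ B)
    leaf#XB = proj₁ (proj₂ (proj₂ (proj₂ chosen)))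
    V : Subset n
    V = B ∪ ⋃ᶠ leaf
    V≤ : ∣ V ∣ ≤ width
    V≤ = ≤-trans (∣p∪q∣≤∣p∣+∣q∣ B (⋃ᶠ leaf))
      (+-mono-≤ (≤-trans (≤-reflexive ∣B∣≡b) b≤r) (∣⋃ᶠ∣≤ leaf (proj₁ (proj₂ (proj₂ chosen)))))
    V#X : Disjoint V X
    V#X = Disjoint-∪ˡ {p₁ = B} {⋃ᶠ leaf} B#X λ x∈⋃ x∈X →
      let j , x∈l = ∈⋃ᶠ⁻ leaf x∈⋃ in leaf#XB j x∈l (∈∪ˡ {q = B} x∈X)

  extendable⇒branch : ∀ {A Q} → ∣ A ∣ ≡ a → Extendable A (A ∪ Q) → ∀ X → ∣ X ∣ ≤ few → A ⊆ X → Disjoint Q X →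
    Σ (Subset n) λ V → ∣ V ∣ ≤ width × Disjoint V X × Branch A V
  extendable⇒branch {A} {Q} ∣A∣≡a ext X ∣X∣≤ A⊆X Q#X with ext X (≤-trans ∣X∣≤ few≤L)
  ... | f , Ef , AQ⊆f , f#X , ker = kernel⇒branch X ∣X∣≤ stem#X
    (+-cancelˡ-≡ a _ _ (trans (cong (_+ ∣ f ─ A ∣) (sym ∣A∣≡a)) (trans (∣p∣+∣q─p∣≡∣q∣ A⊆f) (trans (uniform H f Ef) (sym a+b≡r)))))
    (subst (IsEdge H) (sym (p∪[q─p]≡q A⊆f)) Ef) ker
    where
    A⊆f : A ⊆ f
    A⊆f x∈A = AQ⊆f (∈∪ˡ {q = Q} x∈A)
    stem#X : Disjoint (f ─ A) X
    stem#X {x} x∈ with x ∈? Q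
    ... | yes x∈Q = Q#X x∈Q
    ... | no x∉Q = let x∈f , x∉A = x∈p─q⁻ f A x∈
                   in f#X (x∈p∧x∉q⇒x∈p─q x∈f λ x∈AQ → [ x∉A , x∉Q ]′ (x∈p∪q⁻ A Q x∈AQ))

  -- `k` may be smaller than `s` and `X` larger than `A`, which leaves room for a branch obtained in
  -- another way.
  branches : ∀ {A k} → ∣ A ∣ ≡ a → (Q : Fin k → Subset n) → (∀ i → ∣ Q i ∣ ≤ width) →
    (∀ {i j} → i ≢ j → Disjoint (Q i) (Q j)) → (∀ i → Extendable A (A ∪ Q i)) →
    ∀ X → A ⊆ X → (∀ i → Disjoint (Q i) X) → ∣ X ∣ ≤ 3 * r → k ≤ s →
    Σ (Fin k → Subset n) λ V → (∀ i → Branch A (V i)) × (∀ i → Disjoint (V i) X) ×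
      (∀ {i j} → i ≢ j → Disjoint (V i) (V j))
  branches {A} {k} ∣A∣≡a Q Q≤ Q# ext X A⊆X QX ∣X∣≤ k≤s =
    let V , br , _ , V#X , V# = greedy (3 * r + s * width) width k (λ _ → Branch A) Q Q≤ Q# choose X QX
          (≤-trans (+-mono-≤ ∣X∣≤ (*-monoˡ-≤ width k≤s)) (m≤m+n _ width))
    in V , br , V#X , V#
    where
    choose : ∀ i Y → ∣ Y ∣ ≤ 3 * r + s * width → Disjoint (Q i) Y → Σ (Subset n) λ V → ∣ V ∣ ≤ width × Disjoint V Y × Branch A V
    choose i Y ∣Y∣≤ Q#Y =
      let V , V≤ , V#AY , br = extendable⇒branch ∣A∣≡a (ext i) (A ∪ Y)
            (≤-trans (∣p∪q∣≤∣p∣+∣q∣ A Y) (+-mono-≤ a≤r ∣Y∣≤)) (∈∪ˡ {q = Y})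
            (Disjoint-∪ʳ {q₁ = A} {Y} (λ x∈Q x∈A → QX i x∈Q (A⊆X x∈A)) Q#Y)
      in V , V≤ , (λ x∈V x∈Y → V#AY x∈V (∈∪ʳ {p = A} x∈Y)) , br
      where
      a≤r : ∣ A ∣ ≤ r
      a≤r = ≤-trans (≤-reflexive ∣A∣≡a) (≤-trans (m≤m+n a b) (≤-reflexive a+b≡r))

  extendables⇒bush : ∀ {A} → ∣ A ∣ ≡ a → (Q : Fin s → Subset n) → (∀ i → ∣ Q i ∣ ≤ width) → (∀ i → Disjoint (Q i) A) →
    (∀ {i j} → i ≢ j → Disjoint (Q i) (Q j)) → (∀ i → Extendable A (A ∪ Q i)) → ContainsBush H a b s h
  extendables⇒bush {A} ∣A∣≡a Q Q≤ Q#A Q# ext =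
    let V , br , V#A , V# = branches ∣A∣≡a Q Q≤ Q# ext A id Q#A ∣A∣≤ ≤-refl
    in branches⇒bush ∣A∣≡a V br V#A V#
    where
    ∣A∣≤ : ∣ A ∣ ≤ 3 * r
    ∣A∣≤ = ≤-trans (≤-reflexive ∣A∣≡a) (≤-trans (m≤m+n a b) (≤-trans (≤-reflexive a+b≡r) (m≤m+n r _)))

  extendable⇒bush : ∀ {A} → ∣ A ∣ ≡ a → Extendable A A → ContainsBush H a b s h
  extendable⇒bush {A} ∣A∣≡a ext = extendables⇒bush ∣A∣≡a (λ _ → ⊥) (λ _ → ≤-trans (≤-reflexive (∣⊥∣≡0 n)) z≤n)
    (λ _ x∈ → contradiction x∈ ∉⊥) (λ _ x∈ → contradiction x∈ ∉⊥) (λ _ → subst (Extendable A) (sym (∪-identityʳ A)) ext)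

  -- Each `u` is reserved for the stem of its own branch, so `s` distinct vertices suffice although
  -- the edges through them may meet otherwise. This is the source of the coefficient `s ∸ 1`.
  manyExtensions⇒bush : ∀ {A} → ∣ A ∣ ≡ a → 1 ≤ r → (D : Subset n) → s ≤ ∣ D ∣ → (∀ {u} → u ∈ D → u ∉ A) →
    (∀ {u} → u ∈ D → Extendable A (A ∪ ⁅ u ⁆)) → ContainsBush H a b s h
  manyExtensions⇒bush {A} ∣A∣≡a 1≤r D s≤ D#A ext =
    let u , u∈D , u-inj = ≤∣∣⇒injection D s≤
    in extendables⇒bush ∣A∣≡a (λ i → ⁅ u i ⁆) (λ i → ≤-trans (≤-reflexive (∣⁅x⁆∣≡1 (u i))) (≤-trans 1≤r (m≤m+n r _)))
      (λ i → ∉⇒Disjoint-⁅⁆ (D#A (u∈D i))) (λ {i} {j} i≢j → ∉⇒Disjoint-⁅⁆ λ ui∈uj → i≢j (u-inj (x∈⁅y⁆⇒x≡y (u j) ui∈uj)))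
      (λ i → ext (u∈D i))

-- Edges as vectors of coordinates

allSubsets-unique : ∀ n → Unique (allSubsets n)
allSubsets-unique zero = [] ∷ []
allSubsets-unique (suc n) = Unique.++⁺ (Unique.map⁺ ∷-injectiveʳ (allSubsets-unique n)) (Unique.map⁺ ∷-injectiveʳ (allSubsets-unique n))
  λ (x∈ , y∈) → case ∈-map⁻ (false ∷_) x∈ , ∈-map⁻ (true ∷_) y∈ of λ { ((_ , _ , refl) , (_ , _ , ())) }

module Edges {r n : ℕ} (H : Hypergraph r n) where
  Edge : Set
  Edge = Σ (Subset n) (IsEdge H)

  -- The coordinates of an edge are its vertices in increasing order. This takes the place of an
  -- `r`-partition of the vertex set: agreeing on `P` means having the same vertices at the same
  -- ranks.
  co : Edge → Fin r → Fin n
  co (S , E) = proj₁ (listing S (uniform H S E))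

  co-injective : ∀ e {i j} → co e i ≡ co e j → i ≡ j
  co-injective (S , E) = proj₁ (proj₂ (listing S (uniform H S E)))

  co-∈ : ∀ e i → co e i ∈ proj₁ e
  co-∈ (S , E) = proj₁ (proj₂ (proj₂ (listing S (uniform H S E))))

  co-onto : ∀ e {x} → x ∈ proj₁ e → ∃ λ i → co e i ≡ x
  co-onto (S , E) = proj₂ (proj₂ (proj₂ (listing S (uniform H S E))))

  open Families co public

  ≡-edge : ∀ {e f : Edge} → proj₁ e ≡ proj₁ f → e ≡ f
  ≡-edge {S , E} {.S , E′} refl = cong (S ,_) (Decidable⇒UIP.≡-irrelevant 𝔹._≟_ E E′)

  co-ext : ∀ {e f} → (∀ i → co e i ≡ co f i) → e ≡ f
  co-ext {e} {f} eq = ≡-edge (⊆-antisym (sub e f eq) (sub f e (sym ∘ eq)))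
    where
    sub : ∀ e f → (∀ i → co e i ≡ co f i) → proj₁ e ⊆ proj₁ f
    sub e f eq x∈ = let i , coi = co-onto e x∈ in subst (_∈ proj₁ f) (trans (sym (eq i)) coi) (co-∈ f i)

  module _ (e : Edge) (P : Subset r) where
    private
      inImage? : ∀ x → Dec (∃ λ i → i ∈ P × co e i ≡ x)
      inImage? x = anyFin? λ i → (i ∈? P) ×-dec (co e i ≟ᶠ x)

    img : Subset n
    img = ⟦ inImage? ⟧

    ∈img⁻ : ∀ {x} → x ∈ img → ∃ λ i → i ∈ P × co e i ≡ x
    ∈img⁻ = ∈⟦⟧⁻ inImage?

    ∈img⁺ : ∀ {i} → i ∈ P → co e i ∈ img
    ∈img⁺ {i} i∈P = ∈⟦⟧⁺ inImage? (i , i∈P , refl)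

    img⊆ : img ⊆ proj₁ e
    img⊆ x∈ = let i , _ , eq = ∈img⁻ x∈ in subst (_∈ proj₁ e) eq (co-∈ e i)

    co∈img⇒ : ∀ {i} → co e i ∈ img → i ∈ P
    co∈img⇒ x∈ = let j , j∈P , eq = ∈img⁻ x∈ in subst (_∈ P) (co-injective e eq) j∈P

    ∣img∣ : ∣ img ∣ ≡ ∣ P ∣
    ∣img∣ = ≤-antisym
      (injection⇒≤∣∣ P (proj₁ ∘ pre) (proj₁ ∘ proj₂ ∘ pre) λ {i} {j} eq →
        enum-injective img (trans (sym (proj₂ (proj₂ (pre i)))) (trans (cong (co e) eq) (proj₂ (proj₂ (pre j))))))
      (injection⇒≤∣∣ img (co e ∘ enum P) (∈img⁺ ∘ enum-∈ P) (enum-injective P ∘ co-injective e))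
      where
      pre : ∀ i → ∃ λ j → j ∈ P × co e j ≡ enum img i
      pre i = ∈img⁻ (enum-∈ img i)

  img-∁ : ∀ e P → proj₁ e ─ img e P ≡ img e (∁ P)
  img-∁ e P = ⊆-antisym
    (λ {x} x∈ → let x∈e , x∉ = x∈p─q⁻ (proj₁ e) (img e P) x∈
                    i , coi = co-onto e x∈e
                in subst (_∈ img e (∁ P)) coi (∈img⁺ e (∁ P) (x∉p⇒x∈∁p λ i∈P → x∉ (subst (_∈ img e P) coi (∈img⁺ e P i∈P)))))
    (λ {x} x∈ → x∈p∧x∉q⇒x∈p─q (img⊆ e (∁ P) x∈) λ x∈′ →
      let i , i∈ , coi = ∈img⁻ e (∁ P) x∈ in x∈∁p⇒x∉p i∈ (co∈img⇒ e P (subst (_∈ img e P) (sym coi) x∈′)))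

  Agree-sym : ∀ {P e f} → Agree P e f → Agree P f e
  Agree-sym agree i i∈P = sym (agree i i∈P)

  agree⇒img≡ : ∀ {P e f} → Agree P e f → img e P ≡ img f P
  agree⇒img≡ {P} {e} {f} agree = ⊆-antisym (sub agree) (sub (Agree-sym {P} {e} {f} agree))
    where
    sub : ∀ {e f} → Agree P e f → img e P ⊆ img f P
    sub {e} {f} agree x∈ = let i , i∈P , coi = ∈img⁻ e P x∈
                           in subst (_∈ img f P) (trans (sym (agree i i∈P)) coi) (∈img⁺ f P i∈P)

  pos : Edge → Subset n → Subset r
  pos e K = ⟦ (λ i → co e i ∈? K) ⟧

  ∈pos⁻ : ∀ e K {i} → i ∈ pos e K → co e i ∈ K
  ∈pos⁻ e K = ∈⟦⟧⁻ (λ i → co e i ∈? K)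

  ∈pos⁺ : ∀ e K {i} → co e i ∈ K → i ∈ pos e K
  ∈pos⁺ e K = ∈⟦⟧⁺ (λ i → co e i ∈? K)

  img-pos : ∀ e {K} → K ⊆ proj₁ e → img e (pos e K) ≡ K
  img-pos e {K} K⊆e = ⊆-antisym
    (λ x∈ → let i , i∈ , coi = ∈img⁻ e (pos e K) x∈ in subst (_∈ K) coi (∈pos⁻ e K i∈))
    (λ {x} x∈K → let i , coi = co-onto e (K⊆e x∈K)
                 in subst (_∈ img e (pos e K)) coi (∈img⁺ e (pos e K) (∈pos⁺ e K (subst (_∈ K) (sym coi) x∈K))))

  toEdges : ∀ {Ss} → All (IsEdge H) Ss → List Edge
  toEdges {[]} [] = []
  toEdges {S ∷ _} (E ∷ Es) = (S , E) ∷ toEdges Es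

  map-toEdges : ∀ {Ss} (Es : All (IsEdge H) Ss) → map proj₁ (toEdges Es) ≡ Ss
  map-toEdges [] = refl
  map-toEdges {S ∷ _} (E ∷ Es) = cong (S ∷_) (map-toEdges Es)

  selected : ∀ {Q : Subset n → Set} (Q? : ∀ S → Dec (IsEdge H S × Q S)) → Σ (List Edge) λ F →
    Unique F × (∀ {e} → e ∈ˡ F → Q (proj₁ e)) × length (filter Q? (allSubsets n)) ≤ length F
  selected {Q} Q? = F , Unique.map⁻ (subst Unique (sym (map-toEdges isEdge)) (Unique.filter⁺ Q? (allSubsets-unique n))) ,
    (λ {e} e∈ → proj₂ (proj₂ (∈-filter⁻ Q? {xs = allSubsets n} (subst (proj₁ e ∈ˡ_) (map-toEdges isEdge) (∈-map⁺ proj₁ e∈))))) ,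
    ≤-reflexive (trans (cong length (sym (map-toEdges isEdge))) (length-map proj₁ F))
    where
    Ss = filter Q? (allSubsets n)
    isEdge : All (IsEdge H) Ss
    isEdge = All.tabulate λ S∈ → proj₁ (proj₂ (∈-filter⁻ Q? {xs = allSubsets n} S∈))
    F = toEdges isEdge

  module _ (a b s h : ℕ) (a+b≡r : a + b ≡ r) where
    open Bushes H a b s h a+b≡r

    module ClosedFamily N F (closed : Closed L N F) where
      kernel : ∀ {e} → e ∈ˡ F → ∀ P → Admissible N P → Kernel (img e P)
      kernel {e} e∈F P adm U ∣U∣≤ with closed e∈F P adm U ∣U∣≤
      ... | f , f∈F , agree , avoids = proj₁ f , proj₂ f ,
        subst (_⊆ proj₁ f) (sym img≡) (img⊆ f P) ,
        λ {x} x∈ x∈U → let x∈f , x∉ = x∈p─q⁻ (proj₁ f) (img e P) x∈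
                           i , coi = co-onto f x∈f
                       in avoids i (λ i∈P → x∉ (subst₂ _∈_ coi (sym img≡) (∈img⁺ f P i∈P))) (subst (_∈ U) (sym coi) x∈U)
        where
        img≡ : img e P ≡ img f P
        img≡ = agree⇒img≡ {P} {e} {f} agree

      -- Closedness is used twice: at `Q` it replaces `e` by a member `f` of the same family, and at
      -- `∁ P` it makes the new stem of `f` a kernel. As `P ⊆ Q`, both edges have the same `A`.
      extendable : ∀ {e} → e ∈ˡ F → ∀ P Q → P ⊆ Q → Admissible N Q → Admissible N (∁ P) → Extendable (img e P) (img e Q)
      extendable {e} e∈F P Q P⊆Q admQ adm∁P U ∣U∣≤ with closed e∈F Q admQ U ∣U∣≤
      ... | f , f∈F , agree , avoids = proj₁ f , proj₂ f ,
        subst (_⊆ proj₁ f) (sym img≡) (img⊆ f Q) ,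
        (λ {x} x∈ x∈U → let x∈f , x∉ = x∈p─q⁻ (proj₁ f) (img e Q) x∈
                            i , coi = co-onto f x∈f
                        in avoids i (λ i∈Q → x∉ (subst₂ _∈_ coi (sym img≡) (∈img⁺ f Q i∈Q))) (subst (_∈ U) (sym coi) x∈U)) ,
        subst Kernel (trans (sym (img-∁ f P)) (cong (proj₁ f ─_) (sym (agree⇒img≡ {P} {e} {f} λ i i∈P → agree i (P⊆Q i∈P)))))
          (kernel f∈F (∁ P) adm∁P)
        where
        img≡ : img e Q ≡ img f Q
        img≡ = agree⇒img≡ {Q} {e} {f} agree

      extendable-set : ∀ {e} → e ∈ˡ F → ∀ {A Q} → A ⊆ Q → Q ⊆ proj₁ e → Admissible N (pos e Q) → Admissible N (∁ (pos e A)) →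
        Extendable A Q
      extendable-set {e} e∈F {A} {Q} A⊆Q Q⊆e admQ admA =
        subst₂ Extendable (img-pos e (Q⊆e ∘ A⊆Q)) (img-pos e Q⊆e)
          (extendable e∈F (pos e A) (pos e Q) (λ i∈ → ∈pos⁺ e Q (A⊆Q (∈pos⁻ e A i∈))) admQ admA)

      bush : ∀ {e} → e ∈ˡ F → ∀ P → ∣ P ∣ ≡ a → Admissible N P → Admissible N (∁ P) → ContainsBush H a b s h
      bush {e} e∈F P ∣P∣≡a admP adm∁P =
        extendable⇒bush (trans (∣img∣ e P) ∣P∣≡a) (extendable e∈F P P id admP adm∁P)

-- Deciding whether there is a bush

module _ {r n : ℕ} (H : Hypergraph r n) (a b s h : ℕ) where
  private
    size : ℕ
    size = a + (s * b + s * (h * a))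

    coding : Fin size ↔ BushV a b s h
    coding = (↔-id _ ⊎-↔ ((*↔× ⊎-↔ ((↔-id _ ×-↔ *↔×) ↔-∘ *↔×)) ↔-∘ +↔⊎)) ↔-∘ +↔⊎

    open Inverse coding using (to; from; strictlyInverseˡ; strictlyInverseʳ)

    IsBush : (BushV a b s h → Fin n) → Set
    IsBush f = Injective _≡_ _≡_ f
      × (∀ i → edge H (setOf (map f (vA ++ vB i))) ≡ true)
      × (∀ i j → edge H (setOf (map f (vB i ++ vAij i j))) ≡ true)

    IsBush-cong : ∀ {f g} → (∀ v → f v ≡ g v) → IsBush f → IsBush g
    IsBush-cong f≗g (inj , trunk , leaves) =
      (λ {x} {y} eq → inj (trans (f≗g x) (trans eq (sym (f≗g y))))) ,
      (λ i → trans (cong (edge H ∘ setOf) (sym (map-cong f≗g (vA ++ vB i)))) (trunk i)) ,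
      λ i j → trans (cong (edge H ∘ setOf) (sym (map-cong f≗g (vB i ++ vAij i j)))) (leaves i j)

    Injective? : ∀ (f : BushV a b s h → Fin n) → Dec (Injective _≡_ _≡_ f)
    Injective? f = map′
      (λ inj {x} {y} eq → trans (sym (strictlyInverseˡ x)) (trans (cong to (inj (from x) (from y)
        (trans (cong f (strictlyInverseˡ x)) (trans eq (sym (cong f (strictlyInverseˡ y))))))) (strictlyInverseˡ y)))
      (λ inj i j eq → trans (sym (strictlyInverseʳ i)) (trans (cong from (inj eq)) (strictlyInverseʳ j)))
      (allFin? λ i → allFin? λ j → (f (to i) ≟ᶠ f (to j)) →-dec (i ≟ᶠ j))

    IsBush? : ∀ f → Dec (IsBush f)
    IsBush? f = Injective? f ×-dec (allFin? λ i → _ 𝔹.≟ true) ×-dec (allFin? λ i → allFin? λ j → _ 𝔹.≟ true)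

  -- Maps out of the finite set of bush vertices are coded by numbers and searched. This is what
  -- allows the main argument to assume that there is no bush.
  ContainsBush? : Dec (ContainsBush H a b s h)
  ContainsBush? = map′ (λ (k , bush) → finToFun k ∘ from , bush)
    (λ (f , bush) → funToFin (f ∘ to) , IsBush-cong
      (λ v → sym (trans (finToFun-funToFin (f ∘ to) (from v)) (cong f (strictlyInverseˡ v)))) bush)
    (anyFin? λ k → IsBush? (finToFun k ∘ from))

-- Admissible sets of coordinates and the splitting of `N`

⊆⇒Admissible : ∀ {r} {N P : Subset r} → N ⊆ P → Admissible N P
⊆⇒Admissible {r} {N} {P} N⊆P = λ eq → 0≢1+n (trans (sym (trans (cong ∣_∣ (Empty-unique empty)) (∣⊥∣≡0 r))) eq)
  where
  empty : Empty (N ─ P)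
  empty (x , x∈) = let x∈N , x∉P = x∈p─q⁻ N P x∈ in x∉P (N⊆P x∈N)

⊇⇒Admissible : ∀ {r} {N P M : Subset r} → M ⊆ N → (∀ {x} → x ∈ M → x ∉ P) → 2 ≤ ∣ M ∣ → Admissible N P
⊇⇒Admissible M⊆N M#P 2≤ eq = contradiction (≤-trans 2≤ (≤-trans
  (p⊆q⇒∣p∣≤∣q∣ (λ x∈M → x∈p∧x∉q⇒x∈p─q (M⊆N x∈M) (M#P x∈M))) (≤-reflexive eq))) λ { (s≤s ()) }

⊤-Admissible : ∀ {ρ} (i : Fin (3 + ρ)) → Admissible ⊤ ⁅ i ⁆
⊤-Admissible {ρ} i = ⊇⇒Admissible {N = ⊤} {M = ⊤ {3 + ρ} - i} (λ _ → ∈⊤) (λ x∈ → proj₂ (x∈p─q⁻ (⊤ {3 + ρ}) ⁅ i ⁆ x∈))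
  (≤-pred (≤-trans (s≤s (s≤s (s≤s z≤n))) (≤-reflexive (sym (trans (∣p-x∣+1≡∣p∣ {3 + ρ} {i} {⊤} ∈⊤) (∣⊤∣≡n (3 + ρ)))))))

∣p∣≡1⇒⊆⁅⁆ : (p : Subset n) → ∣ p ∣ ≡ 1 → ∃ λ x → x ∈ p × p ⊆ ⁅ x ⁆
∣p∣≡1⇒⊆⁅⁆ p eq = let g , _ , g∈ , _ = listing p eq in g zero , g∈ zero ,
  ⊆∧∣∣≥⇒⊇ (⁅⁆-⊆ (g∈ zero)) (≤-reflexive (trans eq (sym (∣⁅x⁆∣≡1 (g zero)))))

choosePositions : ∀ {r} (N : Subset r) x y → x ≤ ∣ N ∣ → y ≤ ∣ ∁ N ∣ → Σ (Subset r) λ P →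
  ∣ P ∣ ≡ x + y × x + ∣ N ─ P ∣ ≡ ∣ N ∣ × ∣ N ─ ∁ P ∣ ≡ x
choosePositions N x y x≤ y≤ with ⊆-of-size N x x≤ | ⊆-of-size (∁ N) y y≤
... | p , p⊆N , ∣p∣≡x | q , q⊆∁N , ∣q∣≡y = p ∪ q ,
  trans (∣p∪q∣≡∣p∣+∣q∣ {p = p} {q} p#q) (cong₂ _+_ ∣p∣≡x ∣q∣≡y) ,
  trans (cong₂ _+_ (sym ∣p∣≡x) (cong ∣_∣ N─P)) (∣p∣+∣q─p∣≡∣q∣ p⊆N) ,
  trans (cong ∣_∣ N─∁P) ∣p∣≡x
  where
  N#q : Disjoint N q
  N#q x∈N x∈q = x∈∁p⇒x∉p (q⊆∁N x∈q) x∈N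
  p#q : Disjoint p q
  p#q x∈p = N#q (p⊆N x∈p)
  N─P : N ─ (p ∪ q) ≡ N ─ p
  N─P = ⊆-antisym
    (λ x∈ → let x∈N , x∉ = x∈p─q⁻ N (p ∪ q) x∈ in x∈p∧x∉q⇒x∈p─q x∈N (x∉ ∘ ∈∪ˡ {q = q}))
    (λ x∈ → let x∈N , x∉ = x∈p─q⁻ N p x∈ in x∈p∧x∉q⇒x∈p─q x∈N λ x∈pq → [ x∉ , N#q x∈N ]′ (x∈p∪q⁻ p q x∈pq))
  N─∁P : N ─ ∁ (p ∪ q) ≡ p
  N─∁P = ⊆-antisym
    (λ x∈ → let x∈N , x∉ = x∈p─q⁻ N (∁ (p ∪ q)) x∈ in
      [ id , (λ x∈q → contradiction x∈q (N#q x∈N)) ]′ (x∈p∪q⁻ p q (x∉∁p⇒x∈p x∉)))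
    (λ x∈p → x∈p∧x∉q⇒x∈p─q (p⊆N x∈p) (x∈p⇒x∉∁p (∈∪ˡ {q = q} x∈p)))

-- m is the size of N, and x and z those of its parts among the coordinates of A and of B.
split : ∀ a b m → 2 ≤ b → m ≤ a + b →
  m ≡ 1 ⊎ (a ≤ 1 × b < m) ⊎ (a ≡ 2 × b ≡ 2 × m ≡ 3) ⊎ (∃ λ x → ∃ λ z → m ≡ x + z × x ≤ a × z ≤ b × x ≢ 1 × z ≢ 1)
split a b m 2≤b m≤ with m ≤? b
... | yes m≤b = case m ℕ.≟ 1 of λ
  { (yes m≡1) → inj₁ m≡1
  ; (no m≢1) → inj₂ (inj₂ (inj₂ (0 , m , refl , z≤n , m≤b , (λ ()) , m≢1))) }
... | no m≰b with a ≤? 1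
... | yes a≤1 = inj₂ (inj₁ (a≤1 , ≰⇒> m≰b))
... | no a≰1 with m ≤? a
... | yes m≤a = inj₂ (inj₂ (inj₂ (m , 0 , sym (+-identityʳ m) , m≤a , z≤n ,
        (λ { refl → m≰b (≤-trans (s≤s z≤n) 2≤b) }) , λ ())))
... | no m≰a with m≤n⇒∃[o]m+o≡n (≰⇒> m≰a)
... | suc k , refl = inj₂ (inj₂ (inj₂ (a , 2 + k , trans (sym (+-suc a (suc k))) refl , ≤-refl ,
        +-cancelˡ-≤ a _ _ (≤-trans (≤-reflexive (+-suc a (suc k))) m≤) , (λ { refl → a≰1 ≤-refl }) , λ ())))
-- Here `m = a + 1`, and filling `A` would leave a single element for `B`. Filling `B` instead works
-- if `a > b`; if `a = b`, the parts `2` and `b - 1` work from `b = 3` on.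
... | zero , refl with m≤n⇒∃[o]m+o≡n (≤-pred (≤-trans (≰⇒> m≰b) (≤-reflexive (+-identityʳ (suc a)))))
... | suc k , refl = inj₂ (inj₂ (inj₂ (2 + k , b , arith , +-monoˡ-≤ (suc k) (≤-trans (s≤s z≤n) 2≤b) , ≤-refl ,
        (λ ()) , λ { refl → case 2≤b of λ { (s≤s ()) } })))
        where
        arith : suc (b + suc k) + 0 ≡ 2 + k + b
        arith = solve 2 (λ b k → (con 1 :+ (b :+ (con 1 :+ k))) :+ con 0 := con 2 :+ k :+ b) refl b k
          where open +-*-Solver
split a (suc (suc zero)) m 2≤b m≤ | no m≰b | no a≰1 | no m≰a | zero , refl | zero , refl =
  inj₂ (inj₂ (inj₁ (refl , refl , refl)))
split a (suc zero) m (s≤s ()) m≤ | no m≰b | no a≰1 | no m≰a | zero , refl | zero , refl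
split a (suc (suc (suc k))) m 2≤b m≤ | no m≰b | no a≰1 | no m≰a | zero , refl | zero , refl =
  inj₂ (inj₂ (inj₂ (2 , 2 + k , cong (4 +_) (trans (+-identityʳ (k + 0)) (+-identityʳ k)) ,
    s≤s (s≤s z≤n) , n≤1+n _ , (λ ()) , λ ())))

-- Consequences of having no bush, and the cases with `a ≥ 2`

module Cases {ρ n : ℕ} (H : Hypergraph (3 + ρ) n) (a b s h : ℕ) (a+b≡r : a + b ≡ 3 + ρ) (1≤a : 1 ≤ a) (1≤b : 1 ≤ b)
  (1≤s : 1 ≤ s) (¬bush : ¬ ContainsBush H a b s h) where

  r = 3 + ρ
  open Bushes H a b s h a+b≡r public
  open Edges H public

  a≤r-1 : a ≤ 2 + ρ
  a≤r-1 = ≤-pred (≤-trans (≤-trans (≤-reflexive (+-comm 1 a)) (+-monoʳ-≤ a 1≤b)) (≤-reflexive a+b≡r))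

  -- All `A` are required at once, so that different special vertices of `T` can be used with the
  -- same `A`.
  Special : Subset n → Fin n → Set
  Special T u = ∀ A → A ⊆ T → ∣ A ∣ ≡ a → Extendable A (A ∪ ⁅ u ⁆)

  abstract
    Special? : ∀ T u → Dec (Special T u)
    Special? T u = allSubset? λ A → (A ⊆? T) →-dec ((∣ A ∣ ℕ.≟ a) →-dec Extendable? A (A ∪ ⁅ u ⁆))

  few-extensions : ∀ {A} → ∣ A ∣ ≡ a → (D : Subset n) → (∀ {u} → u ∈ D → u ∉ A) →
    (∀ {u} → u ∈ D → Extendable A (A ∪ ⁅ u ⁆)) → ∣ D ∣ ≤ s ∸ 1
  few-extensions ∣A∣≡a D D#A ext = ≤-pred (≤-trans (≰⇒> λ s≤ → ¬bush (manyExtensions⇒bush ∣A∣≡a (s≤s z≤n) D s≤ D#A ext))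
    (≤-reflexive (sym (m+[n∸m]≡n 1≤s))))

  few-specials : ∀ T → ∣ T ∣ ≡ 2 + ρ → (D : Subset n) → (∀ {u} → u ∈ D → u ∉ T) → (∀ {u} → u ∈ D → Special T u) → ∣ D ∣ ≤ s ∸ 1
  few-specials T ∣T∣ D D#T special =
    let A , A⊆T , ∣A∣≡a = ⊆-of-size T a (≤-trans a≤r-1 (≤-reflexive (sym ∣T∣)))
    in few-extensions ∣A∣≡a D (λ u∈D u∈A → D#T u∈D (A⊆T u∈A)) λ u∈D → special u∈D A A⊆T ∣A∣≡a

  module _ N F (closed : Closed L N F) where
    open ClosedFamily a b s h a+b≡r N F closed

    split⇒⊥ : ∀ {e} → e ∈ˡ F → ∀ x z → ∣ N ∣ ≡ x + z → x ≤ a → z ≤ b → x ≢ 1 → z ≢ 1 → Empty.⊥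
    split⇒⊥ e∈F x z ∣N∣ x≤a z≤b x≢1 z≢1 =
      let P , ∣P∣ , N─P , N─∁P = choosePositions N x (a ∸ x) (≤-trans (m≤m+n x z) (≤-reflexive (sym ∣N∣)))
            (+-cancelˡ-≤ ∣ N ∣ _ _ (begin
              ∣ N ∣ + (a ∸ x)      ≡⟨ trans (cong (_+ (a ∸ x)) (trans ∣N∣ (+-comm x z))) (trans (+-assoc z x (a ∸ x)) (cong (z +_) (m+[n∸m]≡n x≤a))) ⟩
              z + a                ≤⟨ +-monoˡ-≤ a z≤b ⟩
              b + a                ≡⟨ trans (+-comm b a) a+b≡r ⟩
              r                    ≡⟨ sym (trans (cong (∣ N ∣ +_) (∣∁p∣≡n∸∣p∣ N)) (m+[n∸m]≡n (∣p∣≤n N))) ⟩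
              ∣ N ∣ + ∣ ∁ N ∣      ∎))
      in ¬bush (bush e∈F P (trans ∣P∣ (m+[n∸m]≡n x≤a))
           (λ eq → z≢1 (+-cancelˡ-≡ x z 1 (trans (sym ∣N∣) (trans (sym N─P) (cong (x +_) eq)))))
           (λ eq → x≢1 (trans (sym N─∁P) eq)))
      where open ≤-Reasoning

    special-singleton : ∀ {e} → e ∈ˡ F → ∣ N ∣ ≡ 1 → ∃ λ i → Special (proj₁ e - co e i) (co e i)
    special-singleton {e} e∈F ∣N∣≡1 with ∣p∣≡1⇒⊆⁅⁆ N ∣N∣≡1
    ... | i , _ , N⊆i = i , λ A A⊆ _ → extendable-set e∈F (∈∪ˡ {q = ⁅ co e i ⁆})
      (∪-⊆ {p = A} {⁅ co e i ⁆} (p-x⊆p {p = proj₁ e} ∘ A⊆) (⁅⁆-⊆ (co-∈ e i)))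
      (⊆⇒Admissible λ j∈N → ∈pos⁺ e _ (∈∪ʳ {p = A} (subst (λ j → co e j ∈ ⁅ co e i ⁆) (sym (x∈⁅y⁆⇒x≡y i (N⊆i j∈N))) (x∈⁅x⁆ (co e i)))))
      (⊆⇒Admissible λ {j} j∈N → x∉p⇒x∈∁p λ j∈ →
        x∉p-x {p = proj₁ e} (A⊆ (subst (λ j → co e j ∈ A) (x∈⁅y⁆⇒x≡y i (N⊆i j∈N)) (∈pos⁻ e A j∈))))

    -- For `b = 1` the only possible `A` is the whole face, and `A ∪ u` is the edge itself. So all
    -- that matters is a coordinate `i` whose singleton is admissible. If `∣ N ∣ ≢ 1`, any `i`
    -- outside `N` will do, and if `N` is everything, any `i` at all because `r ≥ 3`.
    special-b≡1 : ∀ {e} → e ∈ˡ F → b ≡ 1 → ∃ λ i → Special (proj₁ e - co e i) (co e i)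
    special-b≡1 {e} e∈F b≡1 with ∣ N ∣ ℕ.≟ 1
    ... | yes ∣N∣≡1 = special-singleton e∈F ∣N∣≡1
    ... | no ∣N∣≢1 = i , λ A A⊆ ∣A∣≡a → extendable-set e∈F (∈∪ˡ {q = ⁅ co e i ⁆})
      (∪-⊆ {p = A} {⁅ co e i ⁆} (p-x⊆p {p = proj₁ e} ∘ A⊆) (⁅⁆-⊆ (co-∈ e i)))
      (⊆⇒Admissible {N = N} λ {j} _ → ∈pos⁺ e _ (case j ≟ᶠ i of λ
        { (yes refl) → ∈∪ʳ {p = A} (x∈⁅x⁆ (co e i))
        ; (no j≢i) → ∈∪ˡ {q = ⁅ co e i ⁆} (rest⊆A A⊆ ∣A∣≡a (x∈p∧x≢y⇒x∈p-y (co-∈ e j) (j≢i ∘ co-injective e))) }))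
      (subst (Admissible N) (sym (posA A⊆ ∣A∣≡a)) admissible)
      where
      choice : ∃ λ i → Admissible N ⁅ i ⁆
      choice with nonempty? (∁ N)
      ... | yes (i , i∈∁N) = i , λ eq → ∣N∣≢1 (trans (cong ∣_∣ (sym (⊆-antisym (p─q⊆p N ⁅ i ⁆)
              (λ x∈N → x∈p∧x≢y⇒x∈p-y x∈N λ { refl → x∈∁p⇒x∉p i∈∁N x∈N })))) eq)
      ... | no empty = zero , subst (λ N → Admissible N ⁅ zero ⁆)
              (⊆-antisym (λ {x} _ → x∉∁p⇒x∈p λ x∈ → empty (x , x∈)) ⊆⊤) (⊤-Admissible {ρ} zero)
      i = proj₁ choice
      admissible = proj₂ choice
      rest⊆A : ∀ {A} → A ⊆ proj₁ e - co e i → ∣ A ∣ ≡ a → proj₁ e - co e i ⊆ A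
      rest⊆A A⊆ ∣A∣≡a = ⊆∧∣∣≥⇒⊇ A⊆ (≤-pred (≤-reflexive (trans (∣p-x∣+1≡∣p∣ (co-∈ e i)) (trans (uniform H _ (proj₂ e))
        (trans (sym a+b≡r) (trans (cong₂ _+_ (sym ∣A∣≡a) b≡1) (+-comm _ 1)))))))
      posA : ∀ {A} → A ⊆ proj₁ e - co e i → ∣ A ∣ ≡ a → ∁ (pos e A) ≡ ⁅ i ⁆
      posA {A} A⊆ ∣A∣≡a = ⊆-antisym
        (λ {j} j∈ → case j ≟ᶠ i of λ
          { (yes refl) → x∈⁅x⁆ i
          ; (no j≢i) → contradiction (∈pos⁺ e A (rest⊆A A⊆ ∣A∣≡a (x∈p∧x≢y⇒x∈p-y (co-∈ e j) (j≢i ∘ co-injective e)))) (x∈∁p⇒x∉p j∈) })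
        (⁅⁆-⊆ (x∉p⇒x∈∁p λ i∈ → x∉p-x {p = proj₁ e} (A⊆ (∈pos⁻ e A i∈))))

    N-cases : ∀ {e} → e ∈ˡ F → 2 ≤ b → ∣ N ∣ ≡ 1 ⊎ (a ≤ 1 × b < ∣ N ∣) ⊎ (a ≡ 2 × b ≡ 2 × ∣ N ∣ ≡ 3)
    N-cases e∈F 2≤b with split a b ∣ N ∣ 2≤b (≤-trans (∣p∣≤n N) (≤-reflexive (sym a+b≡r)))
    ... | inj₁ c = inj₁ c
    ... | inj₂ (inj₁ c) = inj₂ (inj₁ c)
    ... | inj₂ (inj₂ (inj₁ c)) = inj₂ (inj₂ c)
    ... | inj₂ (inj₂ (inj₂ (x , z , ∣N∣ , x≤a , z≤b , x≢1 , z≢1))) = ⊥-elim (split⇒⊥ e∈F x z ∣N∣ x≤a z≤b x≢1 z≢1)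

  module _ (c : Subset n → Fin n → ℕ) (K : ℕ)
    (capacity : ∀ T → ∣ T ∣ ≡ 2 + ρ → ∑ (allFin n) (λ u → 𝟙 (does (Link? H T u)) * c T u) ≤ K * (s ∸ 1)) where
    open Charging H c K (s ∸ 1) capacity

    load-term : ∀ e i → c (proj₁ e - co e i) (co e i) ≤ load (proj₁ e)
    load-term e i = ≤-trans (≤-reflexive (sym (trans (cong (λ β → 𝟙 β * c (proj₁ e - co e i) (co e i)) ([]=⇒lookup (co-∈ e i))) (*-identityˡ _))))
      (∑-term≤ (allFin n) (λ u → 𝟙 (lookup (proj₁ e) u) * c (proj₁ e - u) u) (∈-allFin (co e i)))

    sparse : ∀ M → 0 < K →
      (∀ F → Unique F → (∀ {e} → e ∈ˡ F → load (proj₁ e) < K) → length F ≤ M) → numEdges H ≤ (s ∸ 1) * shadowSize H + M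
    sparse M 0<K small = ≤-trans (numEdges≤ 0<K) (+-monoʳ-≤ ((s ∸ 1) * shadowSize H)
      (let F , uF , under , len = selected Underloaded? in ≤-trans len (small F uF under)))

    -- Closed families are sought among the underloaded edges only; the others are already counted
    -- with the exact coefficient.
    sparse-closed : 0 < K → (∀ N F {e} → (∀ {e} → e ∈ˡ F → load (proj₁ e) < K) → e ∈ˡ F → ¬ Closed L N F) →
      numEdges H ≤ (s ∸ 1) * shadowSize H + familyConstant L₀ (1 + ρ) * n ^ (1 + ρ)
    sparse-closed 0<K ¬closed = sparse (familyConstant L₀ (1 + ρ) * n ^ (1 + ρ)) 0<K λ F uF under → noClosed⇒length≤ {Edge} {1 + ρ} {n} L₀ co co-ext F uF
      λ N F′ F′⊆F e∈F′ → ¬closed N F′ (λ {e} e∈ → under {e} (F′⊆F e∈)) e∈F′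

  ∑-indicator≤ : ∀ {T} {Q : Fin n → Set} (Q? : ∀ u → Dec (Q u)) {k} →
    ((D : Subset n) → (∀ {u} → u ∈ D → Link H T u) → (∀ {u} → u ∈ D → Q u) → ∣ D ∣ ≤ k) →
    ∑ (allFin n) (λ u → 𝟙 (does (Link? H T u)) * 𝟙 (does (Q? u))) ≤ k
  ∑-indicator≤ {T} {Q} Q? {k} D≤ = ≤-trans (∑≤ D 1 _ (λ u _ → term≤1 u (Link? H T u) (Q? u)) (λ u u∉D → term≡0 u u∉D (Link? H T u) (Q? u)))
    (≤-trans (≤-reflexive (*-identityˡ ∣ D ∣)) (D≤ D (proj₁ ∘ ∈⟦⟧⁻ both?) (proj₂ ∘ ∈⟦⟧⁻ both?)))
    where
    both? : ∀ u → Dec (Link H T u × Q u)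
    both? u = Link? H T u ×-dec Q? u
    D = ⟦ both? ⟧
    term≤1 : ∀ u (l? : Dec (Link H T u)) (q? : Dec (Q u)) → 𝟙 (does l?) * 𝟙 (does q?) ≤ 1
    term≤1 u (no _) _ = z≤n
    term≤1 u (yes _) (yes _) = ≤-refl
    term≤1 u (yes _) (no _) = z≤n
    term≡0 : ∀ u → u ∉ D → (l? : Dec (Link H T u)) (q? : Dec (Q u)) → 𝟙 (does l?) * 𝟙 (does q?) ≡ 0
    term≡0 u u∉ (no _) _ = refl
    term≡0 u u∉ (yes _) (no _) = refl
    term≡0 u u∉ (yes l) (yes q) = contradiction (∈⟦⟧⁺ both? (l , q)) u∉

  -- The assumption leaves `b = 1` or `∣ N ∣ ≡ 1`. In both cases an edge of a closed family has a
  -- special vertex, and the opposite face makes a full payment, so no fractions are needed.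
  generic : (2 ≤ b → 2 ≤ a × ¬ (a ≡ 2 × b ≡ 2)) →
    numEdges H ≤ (s ∸ 1) * shadowSize H + familyConstant L₀ (1 + ρ) * n ^ (1 + ρ)
  generic ok = sparse-closed c 1 capacity ≤-refl λ N F {e} under e∈F closed →
    let i , special = hasSpecial N F closed e∈F
    in <⇒≱ (under e∈F) (≤-trans (≤-reflexive (sym (cong 𝟙 (does-true⁺ (Special? _ _) special)))) (load-term c 1 capacity e i))
    where
    c : Subset n → Fin n → ℕ
    c T u = 𝟙 (does (Special? T u))
    capacity : ∀ T → ∣ T ∣ ≡ 2 + ρ → ∑ (allFin n) (λ u → 𝟙 (does (Link? H T u)) * c T u) ≤ 1 * (s ∸ 1)
    capacity T ∣T∣ = ≤-trans (∑-indicator≤ (Special? T) λ D link special → few-specials T ∣T∣ D (proj₁ ∘ link) special)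
      (≤-reflexive (sym (*-identityˡ (s ∸ 1))))
    hasSpecial : ∀ N F {e} → Closed L N F → e ∈ˡ F → ∃ λ i → Special (proj₁ e - co e i) (co e i)
    hasSpecial N F closed e∈F with 2 ≤? b
    ... | no ≱2 = special-b≡1 N F closed e∈F (≤-antisym (≤-pred (≰⇒> ≱2)) 1≤b)
    ... | yes 2≤b with N-cases N F closed e∈F 2≤b
    ... | inj₁ ∣N∣≡1 = special-singleton N F closed e∈F ∣N∣≡1
    ... | inj₂ (inj₁ (a≤1 , _)) = contradiction (proj₁ (ok 2≤b)) (<⇒≱ (s≤s a≤1))
    ... | inj₂ (inj₂ (a≡2 , b≡2 , _)) = contradiction (a≡2 , b≡2) (proj₂ (ok 2≤b))

-- For a = b = 2, a family closed for a 3-element N (say a Steiner system on three coordinates times a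
-- free coordinate y) contains no bush by itself and its edges need not have a special vertex. Such an
-- edge e charges each of the three sets e - u with u ≠ y, through the pair e - u - y.
module TwoTwo {ρ n : ℕ} (H : Hypergraph (3 + ρ) n) (a b s h : ℕ) (a+b≡r : a + b ≡ 3 + ρ) (1≤a : 1 ≤ a) (1≤b : 1 ≤ b)
  (1≤s : 1 ≤ s) (¬bush : ¬ ContainsBush H a b s h) (a≡2 : a ≡ 2) (b≡2 : b ≡ 2) where
  open Cases H a b s h a+b≡r 1≤a 1≤b 1≤s ¬bush

  private
    r≡4 : r ≡ 4
    r≡4 = trans (sym a+b≡r) (cong₂ _+_ a≡2 b≡2)

    Through : Subset n → Fin n → Fin n → Set
    Through T u y = y ∈ T × Extendable (T - y) ((T - y) ∪ ⁅ u ⁆)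

    Through? : ∀ T u y → Dec (Through T u y)
    Through? T u y = (y ∈? T) ×-dec Extendable? (T - y) ((T - y) ∪ ⁅ u ⁆)

    -- Payments are in thirds, one for each pair `T - y` through which `u` extends. Each of the
    -- three pairs of `T` serves at most `s ∸ 1` vertices. An edge with a special vertex gets three
    -- thirds from one face; for `∣ N ∣ ≡ 3` it gets one third from each of three faces.
    c : Subset n → Fin n → ℕ
    c T u = ∑ (allFin n) (λ y → 𝟙 (does (Through? T u y)))

    1≤𝟙 : ∀ {A : Set} (A? : Dec A) → A → 1 ≤ 𝟙 (does A?)
    1≤𝟙 A? x = ≤-reflexive (cong 𝟙 (sym (does-true⁺ A? x)))

    capacity : ∀ T → ∣ T ∣ ≡ 2 + ρ → ∑ (allFin n) (λ u → 𝟙 (does (Link? H T u)) * c T u) ≤ 3 * (s ∸ 1)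
    capacity T ∣T∣ = begin
      ∑ Vs (λ u → 𝟙 (does (Link? H T u)) * c T u)
        ≡⟨ trans (∑-cong Vs (λ u → sym (∑-* Vs (𝟙 (does (Link? H T u))) _))) (∑-swap Vs Vs _) ⟩
      ∑ Vs (λ y → ∑ Vs (λ u → 𝟙 (does (Link? H T u)) * 𝟙 (does (Through? T u y))))
        ≤⟨ ∑≤ T (s ∸ 1) _
             (λ y y∈T → ∑-indicator≤ (λ u → Through? T u y) λ D link through → few-extensions
               (trans (cong pred (trans (∣p-x∣+1≡∣p∣ y∈T) (trans ∣T∣ (cong pred r≡4)))) (sym a≡2)) D (λ u∈D u∈ → proj₁ (link u∈D) (p-x⊆p {p = T} u∈)) (proj₂ ∘ through))
             (λ y y∉T → trans (∑-cong Vs (λ u → vanish y∉T u (Through? T u y))) (∑-0 Vs)) ⟩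
      (s ∸ 1) * ∣ T ∣
        ≡⟨ trans (cong ((s ∸ 1) *_) (trans ∣T∣ (cong pred r≡4))) (*-comm (s ∸ 1) 3) ⟩
      3 * (s ∸ 1) ∎
      where
      open ≤-Reasoning
      Vs = allFin n
      vanish : ∀ {y} → y ∉ T → ∀ u (t? : Dec (Through T u y)) → 𝟙 (does (Link? H T u)) * 𝟙 (does t?) ≡ 0
      vanish y∉T u (yes (y∈T , _)) = contradiction y∈T y∉T
      vanish y∉T u (no _) = *-zeroʳ (𝟙 (does (Link? H T u)))

    open Charging H c 3 (s ∸ 1) capacity using (load)

    singleton-load : ∀ N F {e} → Closed L N F → e ∈ˡ F → ∣ N ∣ ≡ 1 → 3 ≤ load (proj₁ e)
    singleton-load N F {e} closed e∈F ∣N∣≡1 = begin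
      3                  ≡⟨ sym ∣T∣ ⟩
      ∣ T ∣              ≤⟨ ≤∑ T _ (λ y y∈T → 1≤𝟙 (Through? T u y) (y∈T , special (T - y) (p-x⊆p {p = T})
                              (trans (cong pred (trans (∣p-x∣+1≡∣p∣ y∈T) ∣T∣)) (sym a≡2)))) ⟩
      c T u              ≤⟨ load-term c 3 capacity e i ⟩
      load (proj₁ e)     ∎
      where
      open ≤-Reasoning
      i = proj₁ (special-singleton N F closed e∈F ∣N∣≡1)
      u = co e i
      T = proj₁ e - u
      special : Special T u
      special = proj₂ (special-singleton N F closed e∈F ∣N∣≡1)
      ∣T∣ : ∣ T ∣ ≡ 3
      ∣T∣ = cong pred (trans (∣p-x∣+1≡∣p∣ (co-∈ e i)) (trans (uniform H _ (proj₂ e)) r≡4))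

    -- For `u` at a coordinate in `N` and `y` at the free coordinate, `A` consists of the other two
    -- vertices at `N`. Then `A ∪ u` covers `N`, while the stem misses two elements of `N` rather
    -- than one.
    triple-load : ∀ N F {e} → Closed L N F → e ∈ˡ F → ∣ N ∣ ≡ 3 → 3 ≤ load (proj₁ e)
    triple-load N F {e} closed e∈F ∣N∣≡3 = ≤-trans (≤-reflexive (sym (trans (∣img∣ e N) ∣N∣≡3))) (≤∑ (img e N) _ loaded)
      where
      open ClosedFamily a b s h a+b≡r N F closed
      S = proj₁ e
      free = ∣p∣≡1⇒⊆⁅⁆ (∁ N) (trans (∣∁p∣≡n∸∣p∣ N) (cong₂ _∸_ r≡4 ∣N∣≡3))
      k = proj₁ free
      k∈∁N = proj₁ (proj₂ free)
      loaded-at : ∀ i → i ∈ N → 1 ≤ 𝟙 (lookup S (co e i)) * c (S - co e i) (co e i)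
      loaded-at i i∈N = ≤-trans (≤-trans (1≤𝟙 (Through? T u y) (y∈T , ext)) (∑-term≤ (allFin n) _ (∈-allFin y)))
          (≤-reflexive (sym (trans (cong (λ β → 𝟙 β * c T u) ([]=⇒lookup (co-∈ e i))) (*-identityˡ _))))
        where
        u = co e i
        y = co e k
        T = S - u
        A = T - y
        i≢k : i ≢ k
        i≢k refl = x∈∁p⇒x∉p k∈∁N i∈N
        y∈T : y ∈ T
        y∈T = x∈p∧x≢y⇒x∈p-y (co-∈ e k) (i≢k ∘ sym ∘ co-injective e)
        ∈A : ∀ {j} → j ≢ i → j ≢ k → co e j ∈ A
        ∈A {j} j≢i j≢k = x∈p∧x≢y⇒x∈p-y (x∈p∧x≢y⇒x∈p-y (co-∈ e j) (j≢i ∘ co-injective e)) (j≢k ∘ co-injective e)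
        N≢k : ∀ {j} → j ∈ N → j ≢ k
        N≢k j∈N refl = x∈∁p⇒x∉p k∈∁N j∈N
        ext : Extendable A (A ∪ ⁅ u ⁆)
        ext = extendable-set e∈F (∈∪ˡ {q = ⁅ u ⁆})
          (∪-⊆ {p = A} {⁅ u ⁆} (p-x⊆p {p = S} ∘ p-x⊆p {p = T}) (⁅⁆-⊆ (co-∈ e i)))
          (⊆⇒Admissible {N = N} λ {j} j∈N → ∈pos⁺ e _ (case j ≟ᶠ i of λ
            { (yes refl) → ∈∪ʳ {p = A} (x∈⁅x⁆ u)
            ; (no j≢i) → ∈∪ˡ {q = ⁅ u ⁆} (∈A j≢i (N≢k j∈N)) }))
          (⊇⇒Admissible {N = N} {M = N - i} (p-x⊆p {p = N})
            (λ {j} j∈ j∈∁ → x∈∁p⇒x∉p j∈∁ (∈pos⁺ e A (∈A (λ { refl → x∉p-x {p = N} j∈ }) (N≢k (p-x⊆p {p = N} j∈)))))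
            (≤-reflexive (sym (cong pred (trans (∣p-x∣+1≡∣p∣ i∈N) ∣N∣≡3)))))

      loaded : ∀ x → x ∈ img e N → 1 ≤ 𝟙 (lookup S x) * c (S - x) x
      loaded x x∈ = let i , i∈N , eq = ∈img⁻ e N x∈
                    in subst (λ x → 1 ≤ 𝟙 (lookup S x) * c (S - x) x) eq (loaded-at i i∈N)

    heavy : ∀ N F {e} → Closed L N F → e ∈ˡ F → 3 ≤ load (proj₁ e)
    heavy N F {e} closed e∈F = byCase (N-cases N F closed e∈F (≤-reflexive (sym b≡2)))
      where
      byCase : ∣ N ∣ ≡ 1 ⊎ (a ≤ 1 × b < ∣ N ∣) ⊎ (a ≡ 2 × b ≡ 2 × ∣ N ∣ ≡ 3) → 3 ≤ load (proj₁ e)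
      byCase (inj₁ ∣N∣≡1) = singleton-load N F {e} closed e∈F ∣N∣≡1
      byCase (inj₂ (inj₁ (a≤1 , _))) = contradiction a≤1 (<⇒≱ (≤-reflexive (sym a≡2)))
      byCase (inj₂ (inj₂ (_ , _ , ∣N∣≡3))) = triple-load N F {e} closed e∈F ∣N∣≡3

  twoTwo : numEdges H ≤ (s ∸ 1) * shadowSize H + familyConstant L₀ (1 + ρ) * n ^ (1 + ρ)
  twoTwo = sparse-closed c 3 capacity (s≤s z≤n) λ N F {e} under e∈F closed →
    <⇒≱ (under {e} e∈F) (heavy N F {e} closed e∈F)

-- The case `a = h = 1`

<⇒∃∉ : {p q : Subset n} → ∣ p ∣ < ∣ q ∣ → ∃ λ x → x ∈ q × x ∉ p
<⇒∃∉ {p = p} {q} p<q with nonempty? (q ─ p)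
... | yes (x , x∈) = x , x∈p─q⁻ q p x∈
... | no empty = contradiction (p⊆q⇒∣p∣≤∣q∣ λ {x} x∈q → case x ∈? p of λ
  { (yes x∈p) → x∈p ; (no x∉p) → ⊥-elim (empty (x , x∈p∧x∉q⇒x∈p─q x∈q x∉p)) }) (<⇒≱ p<q)

-- Records the position of one crowded face, or of two distinct tight ones. Fixing the kind costs a
-- constant factor and makes the positions the same throughout a closed family.
Kind : ℕ → Set
Kind r = Fin r ⊎ (Fin r × Fin r)

kinds : ∀ r → List (Kind r)
kinds r = map inj₁ (allFin r) ++ map inj₂ (cartesianProduct (allFin r) (allFin r))

∈-kinds : ∀ {r} (k : Kind r) → k ∈ˡ kinds r
∈-kinds (inj₁ i) = ∈-++⁺ˡ (∈-map⁺ inj₁ (∈-allFin i))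
∈-kinds {r} (inj₂ (i , j)) = ∈-++⁺ʳ (map inj₁ (allFin r)) (∈-map⁺ inj₂ (∈-cartesianProduct⁺ (∈-allFin i) (∈-allFin j)))

_≟ₖ_ : ∀ {r} (k l : Kind r) → Dec (k ≡ l)
_≟ₖ_ = ⊎-≡-dec _≟ᶠ_ (×-≡-dec _≟ᶠ_ _≟ᶠ_)

module OneTrunk {ρ n : ℕ} (H : Hypergraph (3 + ρ) n) (a b t h : ℕ) (a+b≡r : a + b ≡ 3 + ρ) (1≤a : 1 ≤ a) (1≤b : 1 ≤ b)
  (¬bush : ¬ ContainsBush H a b (suc t) h) (a≡1 : a ≡ 1) (h≡1 : h ≡ 1) (1≤t : 1 ≤ t) where
  s = suc t
  open Cases H a b s h a+b≡r 1≤a 1≤b (s≤s z≤n) ¬bush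

  b≡r-1 : b ≡ 2 + ρ
  b≡r-1 = cong pred (trans (cong (_+ b) (sym a≡1)) a+b≡r)

  ∣⁅x⁆∣≡a : ∀ (x : Fin n) → ∣ ⁅ x ⁆ ∣ ≡ a
  ∣⁅x⁆∣≡a x = trans (∣⁅x⁆∣≡1 x) (sym a≡1)

  neighbours : Subset n → Subset n
  neighbours T = ⟦ Link? H T ⟧

  SpecialLink? : ∀ T u → Dec (Link H T u × Special T u)
  SpecialLink? T u = Link? H T u ×-dec Special? T u

  specials : Subset n → Subset n
  specials T = ⟦ SpecialLink? T ⟧

  ∈specials⁻ : ∀ {T u} → u ∈ specials T → Link H T u × Special T u
  ∈specials⁻ {T} = ∈⟦⟧⁻ (SpecialLink? T)

  ∣specials∣≤ : ∀ T → ∣ T ∣ ≡ 2 + ρ → ∣ specials T ∣ ≤ t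
  ∣specials∣≤ T ∣T∣ = few-specials T ∣T∣ (specials T) (λ u∈ → proj₁ (proj₁ (∈specials⁻ {T} u∈))) (λ u∈ → proj₂ (∈specials⁻ {T} u∈))

  face : Edge → Fin r → Subset n
  face e i = proj₁ e - co e i

  face-link : ∀ e i → Link H (face e i) (co e i)
  face-link e i = Link-─ H (proj₂ e) (co-∈ e i)

  ∣face∣ : ∀ e i → ∣ face e i ∣ ≡ 2 + ρ
  ∣face∣ e i = ∣Link∣ H (face-link e i)

  co-∈face : ∀ e {i j} → j ≢ i → co e j ∈ face e i
  co-∈face e {i} {j} j≢i = x∈p∧x≢y⇒x∈p-y (co-∈ e j) (j≢i ∘ co-injective e)

  -- With `a = h = 1` a single further neighbour `y` of `T` is all the leaves that the stem `T`
  -- needs, so `T` need not be a kernel.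
  link-branch : ∀ {T v y} → Link H T v → Link H T y → Branch ⁅ v ⁆ (T ∪ ⁅ y ⁆)
  link-branch {T} {v} {y} lv ly = record
    { stem = T ; leaf = λ _ → ⁅ y ⁆ ; ∣stem∣ = trans (∣Link∣ H lv) (sym b≡r-1) ; ∣leaf∣ = λ _ → ∣⁅x⁆∣≡a y
    ; stem⊆V = ∈∪ˡ {q = ⁅ y ⁆} ; leaf⊆V = λ _ → ∈∪ʳ {p = T}
    ; stem#leaf = λ _ → Disjoint-sym {p = ⁅ y ⁆} (∉⇒Disjoint-⁅⁆ (proj₁ ly))
    ; leaf#leaf = λ {i} {j} i≢j → contradiction (one-leaf h≡1 i j) i≢j
    ; trunk-edge = subst (IsEdge H) (∪-comm T ⁅ v ⁆) (proj₂ lv) ; leaf-edge = λ _ → proj₂ ly }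
    where
    one-leaf : ∀ {h} → h ≡ 1 → (i j : Fin h) → i ≡ j
    one-leaf refl zero zero = refl

  ∣T∪y∣≤r : ∀ {T y} → Link H T y → ∣ T ∪ ⁅ y ⁆ ∣ ≤ r
  ∣T∪y∣≤r {T} {y} ly = ≤-reflexive (uniform H _ (proj₂ ly))

  r≤width : r ≤ width
  r≤width = m≤m+n r (h * r)

  s*r≤ : s * r ≤ s * width
  s*r≤ = *-monoʳ-≤ s r≤width

  s*r+s*width≤L : s * r + s * width ≤ L
  s*r+s*width≤L = ≤-trans (+-monoˡ-≤ (s * width) (≤-trans s*r≤ (≤-trans (m≤n+m (s * width) (3 * r)) (m≤n+m _ r))))
    (≤-trans (m≤m+n _ width) (n≤1+n _))

  ⊥-small : ∀ {w} → ∣ ⊥ {n} ∣ ≤ w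
  ⊥-small = ≤-trans (≤-reflexive (∣⊥∣≡0 n)) z≤n

  ⊥-Disjoint : ∀ {X : Subset n} → Disjoint ⊥ X
  ⊥-Disjoint x∈ = contradiction x∈ ∉⊥

  -- The shape of a face that is neither crowded nor able to pay one half: its special links use up
  -- its whole budget, and the vertex of `f` is not among them.
  Tight : Fin r → Edge → Set
  Tight i f = t ≤ ∣ specials (face f i) ∣ × ¬ Special (face f i) (co f i)

  module FullyClosed (F : List Edge) (closed : Closed L ⊤ F) where

    star : ∀ {e} → e ∈ˡ F → ∀ i U → ∣ U ∣ ≤ L → ∃ λ f → f ∈ˡ F × co f i ≡ co e i × Disjoint (face f i) U
    star {e} e∈F i U ∣U∣≤ =
      let f , f∈F , agree , avoids = closed e∈F ⁅ i ⁆ (⊤-Admissible {ρ} i) U ∣U∣≤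
      in f , f∈F , sym (agree i (x∈⁅x⁆ i)) , λ {x} x∈ x∈U →
        let j , coj = co-onto f (p-x⊆p {p = proj₁ f} x∈)
        in avoids j (λ j∈i → x∉p-x {p = proj₁ f} (subst (_∈ face f i) (trans (sym coj) (cong (co f) (x∈⁅y⁆⇒x≡y i j∈i))) x∈))
             (subst (_∈ U) (sym coj) x∈U)

    -- A branch at `v` is a face from the star of `v` with a second neighbour as its leaf. Either
    -- such branches exist off every set of `s * r` vertices and are collected greedily, or one such
    -- set captures the leaves of all faces that avoid it.
    module Crowded {e} (e∈F : e ∈ˡ F) (i : Fin r) (crowded : ∀ {f} → f ∈ˡ F → suc s ≤ ∣ neighbours (face f i) ∣) where
      private
        v = co e i

        Available : Subset n → Set
        Available X = Any (λ f → co f i ≡ v × ∃ λ y → y ≢ v × Link H (face f i) y × Disjoint (face f i ∪ ⁅ y ⁆) X) F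

        Available? : ∀ X → Dec (Available X)
        Available? X = Any.any? (λ f → (co f i ≟ᶠ v) ×-dec anyFin? λ y →
          ¬? (y ≟ᶠ v) ×-dec Link? H (face f i) y ×-dec Disjoint? (face f i ∪ ⁅ y ⁆) X) F

        v∉ : ∀ {f} → co f i ≡ v → ∀ {y} → y ≢ v → v ∉ face f i ∪ ⁅ y ⁆
        v∉ {f} cof {y} y≢v v∈ with x∈p∪q⁻ (face f i) ⁅ y ⁆ v∈
        ... | inj₁ v∈f = x∉p-x {p = proj₁ f} (subst (_∈ face f i) (sym cof) v∈f)
        ... | inj₂ v∈y = y≢v (sym (x∈⁅y⁆⇒x≡y y v∈y))

        avoidable : (∀ X → ∣ X ∣ ≤ s * r → Available X) → Empty.⊥
        avoidable available =
          let V , good , _ , _ , V# = greedy (s * r) r s (λ _ V → Branch ⁅ v ⁆ V × Disjoint V ⁅ v ⁆) (λ _ → ⊥) (λ _ → ⊥-small)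
                (λ _ → ⊥-Disjoint) (λ _ X ∣X∣≤ _ → choose X (find (available X ∣X∣≤)))
                ⊥ (λ _ → ⊥-Disjoint) (≤-trans (+-monoˡ-≤ (s * r) (≤-reflexive (∣⊥∣≡0 n))) (m≤m+n _ r))
          in ¬bush (branches⇒bush (∣⁅x⁆∣≡a v) V (proj₁ ∘ good) (proj₂ ∘ good) V#)
          where
          choose : ∀ X → (∃ λ f → f ∈ˡ F × co f i ≡ v × ∃ λ y → y ≢ v × Link H (face f i) y × Disjoint (face f i ∪ ⁅ y ⁆) X) →
            Σ (Subset n) λ V → ∣ V ∣ ≤ r × Disjoint V X × (Branch ⁅ v ⁆ V × Disjoint V ⁅ v ⁆)
          choose X (f , _ , cof , y , y≢v , ly , V#X) = face f i ∪ ⁅ y ⁆ , ∣T∪y∣≤r ly , V#X ,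
            link-branch (subst (Link H (face f i)) cof (face-link f i)) ly ,
            Disjoint-sym {p = ⁅ v ⁆} (∉⇒Disjoint-⁅⁆ (v∉ {f} cof y≢v))

        -- Every star edge avoiding X has all its further neighbours inside X; then s disjoint such edges
        -- take distinct leaves from X.
        stuck : ∀ X → ∣ X ∣ ≤ s * r → ¬ Available X → Empty.⊥
        stuck X ∣X∣≤ unavailable = ¬bush (branches⇒bush (∣⁅x⁆∣≡a v) V
            (λ j → link-branch (link-v j) (link-y j))
            (λ j → Disjoint-sym {p = ⁅ v ⁆} (∉⇒Disjoint-⁅⁆ (v∉ {f j} (cof j) (y≢v j)))) V#)
          where
          Petal : Fin s → Subset n → Set
          Petal _ T = ∃ λ f → f ∈ˡ F × co f i ≡ v × T ≡ face f i
          choosePetal : ∀ (j : Fin s) Y → ∣ Y ∣ ≤ L → Disjoint ⊥ Y → Σ (Subset n) λ T → ∣ T ∣ ≤ r × Disjoint T Y × Petal j T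
          choosePetal _ Y ∣Y∣≤ _ = let f , f∈F , cof , f#Y = star e∈F i Y ∣Y∣≤
            in face f i , ≤-trans (≤-reflexive (∣face∣ f i)) (n≤1+n _) , f#Y , f , f∈F , cof , refl
          petals = greedy L r s Petal (λ _ → ⊥) (λ _ → ⊥-small) (λ _ → ⊥-Disjoint) choosePetal X (λ _ → ⊥-Disjoint)
            (≤-trans (+-mono-≤ ∣X∣≤ s*r≤) (≤-trans s*r+s*width≤L (m≤m+n L r)))
          f : Fin s → Edge
          f j = proj₁ (proj₁ (proj₂ petals) j)
          f∈F : ∀ j → f j ∈ˡ F
          f∈F j = proj₁ (proj₂ (proj₁ (proj₂ petals) j))
          cof : ∀ j → co (f j) i ≡ v
          cof j = proj₁ (proj₂ (proj₂ (proj₁ (proj₂ petals) j)))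
          T≡ : ∀ j → proj₁ petals j ≡ face (f j) i
          T≡ j = proj₂ (proj₂ (proj₂ (proj₁ (proj₂ petals) j)))
          T : Fin s → Subset n
          T j = face (f j) i
          T#X : ∀ j → Disjoint (T j) X
          T#X j x∈ = proj₁ (proj₂ (proj₂ (proj₂ petals))) j (subst (_ ∈_) (sym (T≡ j)) x∈)
          T# : ∀ {j k} → j ≢ k → Disjoint (T j) (T k)
          T# {j} {k} j≢k x∈ x∈′ = proj₂ (proj₂ (proj₂ (proj₂ petals))) j≢k
            (subst (_ ∈_) (sym (T≡ j)) x∈) (subst (_ ∈_) (sym (T≡ k)) x∈′)
          link-v : ∀ j → Link H (T j) v
          link-v j = subst (Link H (T j)) (cof j) (face-link (f j) i)
          Y : Fin s → Subset n
          Y j = neighbours (T j) - v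
          ∣Y∣ : ∀ j → s ≤ ∣ Y j ∣
          ∣Y∣ j = ≤-pred (≤-trans (crowded (f∈F j)) (≤-reflexive (sym (∣p-x∣+1≡∣p∣ (∈⟦⟧⁺ (Link? H (T j)) (link-v j))))))
          -- Besides `v` there are `s` neighbours, one more than the at most `t` leaves to be
          -- avoided.
          chooseLeaf : ∀ (j : Fin s) Z → ∣ Z ∣ ≤ t → Disjoint ⊥ Z →
            Σ (Subset n) λ V → ∣ V ∣ ≤ 1 × Disjoint V Z × (∃ λ y → y ∈ Y j × V ≡ ⁅ y ⁆)
          chooseLeaf j Z ∣Z∣≤ _ = let y , y∈Y , y∉Z = <⇒∃∉ (≤-trans (s≤s ∣Z∣≤) (∣Y∣ j))
            in ⁅ y ⁆ , ≤-reflexive (∣⁅x⁆∣≡1 y) , ∉⇒Disjoint-⁅⁆ y∉Z , y , y∈Y , refl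
          leaves = greedy t 1 s (λ j V → ∃ λ y → y ∈ Y j × V ≡ ⁅ y ⁆) (λ _ → ⊥) (λ _ → ⊥-small) (λ _ → ⊥-Disjoint)
            chooseLeaf ⊥ (λ _ → ⊥-Disjoint)
            (≤-reflexive (trans (cong (_+ s * 1) (∣⊥∣≡0 n)) (trans (*-identityʳ s) (+-comm 1 t))))
          y : Fin s → Fin n
          y j = proj₁ (proj₁ (proj₂ leaves) j)
          y∈Y : ∀ j → y j ∈ Y j
          y∈Y j = proj₁ (proj₂ (proj₁ (proj₂ leaves) j))
          y≢y : ∀ {j k} → j ≢ k → y j ≢ y k
          y≢y {j} {k} j≢k eq = proj₂ (proj₂ (proj₂ (proj₂ leaves))) j≢k
            (subst (y j ∈_) (sym (proj₂ (proj₂ (proj₁ (proj₂ leaves) j)))) (x∈⁅x⁆ (y j)))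
            (subst (y j ∈_) (sym (proj₂ (proj₂ (proj₁ (proj₂ leaves) k)))) (subst (λ x → y j ∈ ⁅ x ⁆) eq (x∈⁅x⁆ (y j))))
          link-y : ∀ j → Link H (T j) (y j)
          link-y j = ∈⟦⟧⁻ (Link? H (T j)) (p-x⊆p {p = neighbours (T j)} (y∈Y j))
          y≢v : ∀ j → y j ≢ v
          y≢v j eq = x∉p-x {p = neighbours (T j)} (subst (_∈ Y j) eq (y∈Y j))
          y∈X : ∀ j → y j ∈ X
          y∈X j = decidable-stable (y j ∈? X) λ y∉X → unavailable (lose (f∈F j) (cof j , y j , y≢v j , link-y j ,
            Disjoint-∪ˡ {p₁ = T j} {⁅ y j ⁆} (T#X j) (∉⇒Disjoint-⁅⁆ y∉X)))
          V : Fin s → Subset n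
          V j = T j ∪ ⁅ y j ⁆
          y∉T : ∀ j k → y j ∉ T k
          y∉T j k y∈T = T#X k y∈T (y∈X j)
          V# : ∀ {j k} → j ≢ k → Disjoint (V j) (V k)
          V# {j} {k} j≢k = Disjoint-∪ˡ {p₁ = T j} {⁅ y j ⁆}
            (Disjoint-∪ʳ {q₁ = T k} {⁅ y k ⁆} (T# j≢k) (Disjoint-sym {p = ⁅ y k ⁆} (∉⇒Disjoint-⁅⁆ (y∉T k j))))
            (Disjoint-∪ʳ {q₁ = T k} {⁅ y k ⁆} (∉⇒Disjoint-⁅⁆ (y∉T j k))
              (∉⇒Disjoint-⁅⁆ λ yj∈yk → y≢y j≢k (x∈⁅y⁆⇒x≡y (y k) yj∈yk)))

      absurd : Empty.⊥
      absurd with anySubset? (λ X → (∣ X ∣ ≤? s * r) ×-dec ¬? (Available? X))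
      ... | yes (X , ∣X∣≤ , unavailable) = stuck X ∣X∣≤ unavailable
      ... | no none = avoidable λ X ∣X∣≤ → decidable-stable (Available? X) λ unavailable → none (X , ∣X∣≤ , unavailable)

    -- With A the x-vertex of both e and e′, the special vertices of e at z give s ∸ 1 branches, and a
    -- neighbour y of e′ at x outside them would give the last one.
    neighbours⊆specials : ∀ {z x e e′ y} → x ≢ z → t ≤ ∣ specials (face e z) ∣ → co e x ≡ co e′ x →
      Disjoint (proj₁ e′) (specials (face e z)) → Link H (face e′ x) y → y ≢ co e′ x → y ∈ specials (face e z)
    neighbours⊆specials {z} {x} {e} {e′} {y} x≢z t≤ co≡ e′#W ly y≢ = decidable-stable (y ∈? W) λ y∉W → ¬bush (bushFrom y∉W)
      where
      W = specials (face e z)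
      v = co e′ x
      w = ≤∣∣⇒injection W t≤
      X = proj₁ e′ ∪ ⁅ y ⁆
      v∈face : v ∈ face e z
      v∈face = subst (_∈ face e z) co≡ (co-∈face e x≢z)
      bushFrom : y ∉ W → ContainsBush H a b s h
      bushFrom y∉W = branches⇒bush (∣⁅x⁆∣≡a v) V branch V#A V#
        where
        w#X : ∀ j → Disjoint ⁅ proj₁ w j ⁆ X
        w#X j = ∉⇒Disjoint-⁅⁆ λ w∈X → [ (λ w∈e′ → e′#W w∈e′ (proj₁ (proj₂ w) j)) ,
          (λ w∈y → y∉W (subst (_∈ W) (x∈⁅y⁆⇒x≡y y w∈y) (proj₁ (proj₂ w) j))) ]′ (x∈p∪q⁻ (proj₁ e′) ⁅ y ⁆ w∈X)
        ∣X∣≤ : ∣ X ∣ ≤ 3 * r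
        ∣X∣≤ = ≤-trans (∣p∪q∣≤∣p∣+∣q∣ (proj₁ e′) ⁅ y ⁆) (+-mono-≤ (≤-reflexive (uniform H _ (proj₂ e′)))
          (≤-trans (≤-reflexive (∣⁅x⁆∣≡1 y)) (s≤s z≤n)))
        others = branches {⁅ v ⁆} {t} (∣⁅x⁆∣≡a v) (λ j → ⁅ proj₁ w j ⁆) (λ j → ≤-trans (≤-reflexive (∣⁅x⁆∣≡1 (proj₁ w j))) (s≤s z≤n))
          (λ {j} {k} j≢k → ∉⇒Disjoint-⁅⁆ λ w∈ → j≢k (proj₂ (proj₂ w) (x∈⁅y⁆⇒x≡y (proj₁ w k) w∈)))
          (λ j → proj₂ (∈specials⁻ {face e z} (proj₁ (proj₂ w) j)) ⁅ v ⁆ (⁅⁆-⊆ v∈face) (∣⁅x⁆∣≡a v))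
          X (⁅⁆-⊆ (∈∪ˡ {q = ⁅ y ⁆} (co-∈ e′ x))) w#X ∣X∣≤ (n≤1+n t)
        V₀ = face e′ x ∪ ⁅ y ⁆
        V₀⊆X : V₀ ⊆ X
        V₀⊆X = ∪-⊆ {p = face e′ x} {⁅ y ⁆} (∈∪ˡ {q = ⁅ y ⁆} ∘ p-x⊆p {p = proj₁ e′}) (∈∪ʳ {p = proj₁ e′})
        V : Fin s → Subset n
        V zero = V₀
        V (suc j) = proj₁ others j
        branch : ∀ j → Branch ⁅ v ⁆ (V j)
        branch zero = link-branch (face-link e′ x) ly
        branch (suc j) = proj₁ (proj₂ others) j
        V#A : ∀ j → Disjoint (V j) ⁅ v ⁆
        V#A zero = Disjoint-sym {p = ⁅ v ⁆} (∉⇒Disjoint-⁅⁆ λ v∈ →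
          [ x∉p-x {p = proj₁ e′} , (λ v∈y → y≢ (sym (x∈⁅y⁆⇒x≡y y v∈y))) ]′ (x∈p∪q⁻ (face e′ x) ⁅ y ⁆ v∈))
        V#A (suc j) u∈ u∈v = proj₁ (proj₂ (proj₂ others)) j u∈ (⁅⁆-⊆ (∈∪ˡ {q = ⁅ y ⁆} (co-∈ e′ x)) u∈v)
        V# : ∀ {j k} → j ≢ k → Disjoint (V j) (V k)
        V# {zero} {zero} j≢k = contradiction refl j≢k
        V# {zero} {suc k} _ u∈ u∈′ = proj₁ (proj₂ (proj₂ others)) k u∈′ (V₀⊆X u∈)
        V# {suc j} {zero} _ u∈ u∈′ = proj₁ (proj₂ (proj₂ others)) j u∈ (V₀⊆X u∈′)
        V# {suc j} {suc k} j≢k = proj₂ (proj₂ (proj₂ others)) (j≢k ∘ cong suc)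

    -- Tightness keeps the vertex of `e′` at `x` out of its special set, so `neighbours⊆specials`
    -- yields one inclusion; equality follows because both sets have exactly `t` elements.
    specials-agree : ∀ {z x e e′} → x ≢ z → Tight z e → Tight x e′ → co e x ≡ co e′ x →
      Disjoint (proj₁ e′) (specials (face e z)) → specials (face e z) ⊆ specials (face e′ x) × specials (face e′ x) ⊆ specials (face e z)
    specials-agree {z} {x} {e} {e′} x≢z (t≤ , _) (t≤′ , ¬special) co≡ e′#W =
      ⊆∧∣∣≥⇒⊇ sub (≤-trans (∣specials∣≤ _ (∣face∣ e z)) t≤′) , sub
      where
      sub : specials (face e′ x) ⊆ specials (face e z)
      sub y∈ = let ly , special = ∈specials⁻ {face e′ x} y∈
               in neighbours⊆specials {z} {x} {e} {e′} x≢z t≤ co≡ e′#W ly λ { refl → ¬special special }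

    -- Passing from `e` to an `f` with the same `z`-vertex, and then to a `g` with the same
    -- `x`-vertex as `f`, preserves the special set `W`. A single move would keep a vertex of `e`;
    -- after two, `g` can avoid any small set. So a fixed `w ∈ W` is linked to the `x`-faces of `s`
    -- disjoint edges `g`, and the `x`-vertex of each is the leaf.
    tight-absurd : ∀ {e z x} → e ∈ˡ F → z ≢ x → (∀ {f} → f ∈ˡ F → Tight z f) → (∀ {f} → f ∈ˡ F → Tight x f) → Empty.⊥
    tight-absurd {e} {z} {x} e∈F z≢x tight-z tight-x =
        ¬bush (branches⇒bush (∣⁅x⁆∣≡a w) (proj₁ chosen) (proj₁ ∘ good) (proj₂ ∘ good) (proj₂ (proj₂ (proj₂ (proj₂ chosen)))))
      where
      W = specials (face e x)
      w-in : ∃ λ w → w ∈ W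
      w-in = let g , g∈ , _ = ≤∣∣⇒injection W (≤-trans 1≤t (proj₁ (tight-x e∈F))) in g zero , g∈ zero
      w = proj₁ w-in
      w∈W = proj₂ w-in
      choose : ∀ (j : Fin s) X → ∣ X ∣ ≤ s * r → Disjoint ⊥ X →
        Σ (Subset n) λ V → ∣ V ∣ ≤ r × Disjoint V X × (Branch ⁅ w ⁆ V × Disjoint V ⁅ w ⁆)
      choose _ X ∣X∣≤ _ = proj₁ g , ≤-reflexive (uniform H _ (proj₂ g)) , (λ u∈ u∈X → g#XW u∈ (∈∪ˡ {q = W} u∈X)) ,
          subst (Branch ⁅ w ⁆) ([p-x]∪⁅x⁆≡p (co-∈ g x)) (link-branch (proj₁ (∈specials⁻ {face g x} w∈Wg)) (face-link g x)) ,
          Disjoint-sym {p = ⁅ w ⁆} (∉⇒Disjoint-⁅⁆ λ w∈g → g#XW w∈g (∈∪ʳ {p = X} w∈W))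
        where
        ∣XW∣≤ : ∣ X ∪ W ∣ ≤ L
        ∣XW∣≤ = ≤-trans (∣p∪q∣≤∣p∣+∣q∣ X W) (≤-trans (+-mono-≤ ∣X∣≤ (≤-trans (∣specials∣≤ _ (∣face∣ e x))
          (≤-trans (n≤1+n t) (≤-trans (≤-reflexive (sym (*-identityʳ s))) (*-monoʳ-≤ s (s≤s z≤n)))))) s*r+s*width≤L)
        first = star e∈F z (X ∪ W) ∣XW∣≤
        f = proj₁ first
        f∈F = proj₁ (proj₂ first)
        f#XW : Disjoint (face f z) (X ∪ W)
        f#XW = proj₂ (proj₂ (proj₂ first))
        second = star f∈F x (X ∪ W) ∣XW∣≤
        g = proj₁ second
        g∈F = proj₁ (proj₂ second)
        outside-face : ∀ h i {q} → Disjoint (face h i) q → co h i ∉ q → Disjoint (proj₁ h) q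
        outside-face h i face#q co∉q {u} u∈h u∈q with u ≟ᶠ co h i
        ... | yes refl = co∉q u∈q
        ... | no u≢ = face#q (x∈p∧x≢y⇒x∈p-y u∈h u≢) u∈q
        -- The vertex that `f` shares with `e` lies in the face defining `W`, hence outside `W`.
        -- Likewise, the vertex that `g` shares with `f` lies in a face of `f` already chosen to
        -- avoid `X ∪ W`.
        f#W : Disjoint (proj₁ f) W
        f#W = outside-face f z (λ u∈ u∈W → f#XW u∈ (∈∪ʳ {p = X} u∈W)) λ co∈W →
          proj₁ (proj₁ (∈specials⁻ {face e x} co∈W)) (subst (_∈ face e x) (sym (proj₁ (proj₂ (proj₂ first)))) (co-∈face e z≢x))
        g#XW : Disjoint (proj₁ g) (X ∪ W)
        g#XW = outside-face g x (proj₂ (proj₂ (proj₂ second))) λ co∈ →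
          f#XW (co-∈face f (z≢x ∘ sym)) (subst (_∈ X ∪ W) (proj₁ (proj₂ (proj₂ second))) co∈)
        Wf = specials-agree {x} {z} {e} {f} z≢x (tight-x e∈F) (tight-z f∈F) (sym (proj₁ (proj₂ (proj₂ first)))) f#W
        w∈Wg : w ∈ specials (face g x)
        w∈Wg = proj₁ (specials-agree {z} {x} {f} {g} (z≢x ∘ sym) (tight-z f∈F) (tight-x g∈F) (sym (proj₁ (proj₂ (proj₂ second))))
          (λ u∈ u∈Wf → g#XW u∈ (∈∪ʳ {p = X} (proj₂ Wf u∈Wf)))) (proj₁ Wf w∈W)
      chosen = greedy (s * r) r s (λ _ V → Branch ⁅ w ⁆ V × Disjoint V ⁅ w ⁆) (λ _ → ⊥) (λ _ → ⊥-small) (λ _ → ⊥-Disjoint)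
        choose ⊥ (λ _ → ⊥-Disjoint) (≤-trans (+-monoˡ-≤ (s * r) (≤-reflexive (∣⊥∣≡0 n))) (m≤m+n _ r))
      good = proj₁ (proj₂ chosen)

  -- In halves, paying 2 for every special link and 1 for every other link costs exactly this sum.
  Light : Subset n → Set
  Light T = ∣ specials T ∣ + ∣ neighbours T ∣ ≤ 2 * t

  Light? : ∀ T → Dec (Light T)
  Light? T = ∣ specials T ∣ + ∣ neighbours T ∣ ≤? 2 * t

  -- A special link is worth 2; a light T can in addition afford 1 for each of its other links.
  bonus : ∀ {T u} → Dec (Light T) → Dec (Special T u) → ℕ
  bonus (yes _) _ = 1
  bonus (no _) special? = 𝟙 (does special?)

  c : Subset n → Fin n → ℕ
  c T u = 𝟙 (does (Special? T u)) + bonus (Light? T) (Special? T u)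

  capacity : ∀ T → ∣ T ∣ ≡ 2 + ρ → ∑ (allFin n) (λ u → 𝟙 (does (Link? H T u)) * c T u) ≤ 2 * t
  capacity T ∣T∣ = begin
    ∑ Vs (λ u → 𝟙 (does (Link? H T u)) * c T u)
      ≡⟨ trans (∑-cong Vs (λ u → *-distribˡ-+ (𝟙 (does (Link? H T u))) _ _)) (∑-+ Vs _ _) ⟩
    ∑ Vs (λ u → 𝟙 (does (Link? H T u)) * 𝟙 (does (Special? T u))) +
    ∑ Vs (λ u → 𝟙 (does (Link? H T u)) * bonus (Light? T) (Special? T u))
      ≤⟨ byLightness (Light? T) ⟩
    2 * t ∎
    where
    open ≤-Reasoning
    Vs = allFin n
    special-links : ∑ Vs (λ u → 𝟙 (does (Link? H T u)) * 𝟙 (does (Special? T u))) ≤ ∣ specials T ∣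
    special-links = ∑-indicator≤ (Special? T) λ D link special →
      p⊆q⇒∣p∣≤∣q∣ λ u∈D → ∈⟦⟧⁺ (SpecialLink? T) (link u∈D , special u∈D)
    links : ∑ Vs (λ u → 𝟙 (does (Link? H T u)) * 1) ≤ ∣ neighbours T ∣
    links = ≤-trans (∑-mono Vs λ u → 𝟙*1≤𝟙*𝟙 (does (Link? H T u)))
      (∑-indicator≤ (Link? H T) λ D link _ → p⊆q⇒∣p∣≤∣q∣ λ u∈D → ∈⟦⟧⁺ (Link? H T) (link u∈D))
      where
      𝟙*1≤𝟙*𝟙 : ∀ β → 𝟙 β * 1 ≤ 𝟙 β * 𝟙 β
      𝟙*1≤𝟙*𝟙 false = z≤n
      𝟙*1≤𝟙*𝟙 true = ≤-refl
    byLightness : (l? : Dec (Light T)) →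
      ∑ Vs (λ u → 𝟙 (does (Link? H T u)) * 𝟙 (does (Special? T u))) +
      ∑ Vs (λ u → 𝟙 (does (Link? H T u)) * bonus l? (Special? T u)) ≤ 2 * t
    byLightness (yes light) = ≤-trans (+-mono-≤ special-links links) light
    byLightness (no _) = ≤-trans (+-mono-≤ special-links special-links)
      (≤-trans (+-mono-≤ (∣specials∣≤ T ∣T∣) (∣specials∣≤ T ∣T∣)) (≤-reflexive (cong (t +_) (sym (+-identityʳ t)))))

  open Charging H c 2 t capacity using (load)

  special⇒loaded : ∀ e i → Special (face e i) (co e i) → 2 ≤ load (proj₁ e)
  special⇒loaded e i special = ≤-trans (worth (Special? _ _) (Light? _)) (load-term c 2 capacity e i)
    where
    worth : (sp? : Dec (Special (face e i) (co e i))) (l? : Dec (Light (face e i))) → 2 ≤ 𝟙 (does sp?) + bonus l? sp?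
    worth (yes _) (yes _) = ≤-refl
    worth (yes _) (no _) = ≤-refl
    worth (no ¬special) _ = contradiction special ¬special

  two-light⇒loaded : ∀ e i j → i ≢ j → Light (face e i) → Light (face e j) → 2 ≤ load (proj₁ e)
  two-light⇒loaded e i j i≢j light-i light-j = ≤-trans (≤-reflexive (sym ∣p∣)) (≤∑ p _ worth)
    where
    p = ⁅ co e i ⁆ ∪ ⁅ co e j ⁆
    ∣p∣ : ∣ p ∣ ≡ 2
    ∣p∣ = trans (∣p∪⁅x⁆∣≡1+∣p∣ λ j∈i → i≢j (sym (co-injective e (x∈⁅y⁆⇒x≡y (co e i) j∈i)))) (cong suc (∣⁅x⁆∣≡1 (co e i)))
    worth-at : ∀ k → Light (face e k) → 1 ≤ 𝟙 (lookup (proj₁ e) (co e k)) * c (face e k) (co e k)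
    worth-at k light = ≤-trans (≤-trans (one (Light? (face e k))) (m≤n+m _ (𝟙 (does (Special? (face e k) (co e k))))))
      (≤-reflexive (sym (trans (cong (λ β → 𝟙 β * c (face e k) (co e k)) ([]=⇒lookup (co-∈ e k))) (*-identityˡ _))))
      where
      one : (l? : Dec (Light (face e k))) → 1 ≤ bonus l? (Special? (face e k) (co e k))
      one (yes _) = ≤-refl
      one (no ¬light) = contradiction light ¬light
    worth : ∀ u → u ∈ p → 1 ≤ 𝟙 (lookup (proj₁ e) u) * c (proj₁ e - u) u
    worth u u∈ = [ at i light-i , at j light-j ]′ (x∈p∪q⁻ ⁅ co e i ⁆ ⁅ co e j ⁆ u∈)
      where
      at : ∀ k → Light (face e k) → u ∈ ⁅ co e k ⁆ → 1 ≤ 𝟙 (lookup (proj₁ e) u) * c (proj₁ e - u) u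
      at k light u∈k = subst (λ u → 1 ≤ 𝟙 (lookup (proj₁ e) u) * c (proj₁ e - u) u) (sym (x∈⁅y⁆⇒x≡y (co e k) u∈k)) (worth-at k light)

  HasKind : Kind r → Edge → Set
  HasKind (inj₁ i) e = suc s ≤ ∣ neighbours (face e i) ∣
  HasKind (inj₂ (z , x)) e = z ≢ x × Tight z e × Tight x e

  heavy-kind : ∀ e {z x} → (∀ i → ¬ Special (face e i) (co e i)) → z ≢ x → ¬ Light (face e z) → ¬ Light (face e x) →
    ∃ λ k → HasKind k e
  heavy-kind e {z} {x} ¬special z≢x heavy-z heavy-x
    with suc s ≤? ∣ neighbours (face e z) ∣ | suc s ≤? ∣ neighbours (face e x) ∣
  ... | yes crowded | _ = inj₁ z , crowded
  ... | no _ | yes crowded = inj₁ x , crowded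
  ... | no sparse-z | no sparse-x = inj₂ (z , x) , z≢x , (tight sparse-z heavy-z , ¬special z) , (tight sparse-x heavy-x , ¬special x)
    where
    -- A heavy face has sum at least `2 * t + 1`, of which at most `t + 1` are neighbours.
    tight : ∀ {T} → ¬ (suc s ≤ ∣ neighbours T ∣) → ¬ Light T → t ≤ ∣ specials T ∣
    tight {T} sparse heavy = ≤-pred (+-cancelʳ-≤ t _ _ (begin
      suc t + t                               ≡⟨ cong (λ m → suc (t + m)) (sym (+-identityʳ t)) ⟩
      suc (2 * t)                             ≤⟨ ≰⇒> heavy ⟩
      ∣ specials T ∣ + ∣ neighbours T ∣       ≤⟨ +-monoʳ-≤ ∣ specials T ∣ (≤-pred (≰⇒> sparse)) ⟩
      ∣ specials T ∣ + suc t                  ≡⟨ +-suc ∣ specials T ∣ t ⟩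
      suc ∣ specials T ∣ + t                  ∎))
      where open ≤-Reasoning

  -- Since `r ≥ 3`, three faces can be compared: two light ones would pay the edge in full, so two
  -- of them are heavy.
  classify : ∀ e → load (proj₁ e) < 2 → ∃ λ k → HasKind k e
  classify e under = pair (Light? (face e i₀)) (Light? (face e i₁)) (Light? (face e i₂))
    where
    i₀ i₁ i₂ : Fin r
    i₀ = zero
    i₁ = suc zero
    i₂ = suc (suc zero)
    ¬special : ∀ i → ¬ Special (face e i) (co e i)
    ¬special i special = <⇒≱ under (special⇒loaded e i special)
    ¬two : ∀ i j → i ≢ j → Light (face e i) → Light (face e j) → ∃ λ k → HasKind k e
    ¬two i j i≢j light-i light-j = contradiction (two-light⇒loaded e i j i≢j light-i light-j) (<⇒≱ under)
    pair : Dec (Light (face e i₀)) → Dec (Light (face e i₁)) → Dec (Light (face e i₂)) → ∃ λ k → HasKind k e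
    pair (no h₀) (no h₁) _ = heavy-kind e {i₀} {i₁} ¬special (λ ()) h₀ h₁
    pair (no h₀) _ (no h₂) = heavy-kind e {i₀} {i₂} ¬special (λ ()) h₀ h₂
    pair _ (no h₁) (no h₂) = heavy-kind e {i₁} {i₂} ¬special (λ ()) h₁ h₂
    pair (yes l₀) (yes l₁) _ = ¬two i₀ i₁ (λ ()) l₀ l₁
    pair (yes l₀) (no _) (yes l₂) = ¬two i₀ i₂ (λ ()) l₀ l₂
    pair (no _) (yes l₁) (yes l₂) = ¬two i₁ i₂ (λ ()) l₁ l₂

  kind : ∀ e → Dec (load (proj₁ e) < 2) → Kind r
  kind e (yes under) = proj₁ (classify e under)
  -- An arbitrary value: kinds matter for underloaded edges only.
  kind e (no _) = inj₁ zero

  kind-correct : ∀ e under? → load (proj₁ e) < 2 → HasKind (kind e under?) e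
  kind-correct e (yes under) _ = proj₂ (classify e under)
  kind-correct e (no ¬under) under = contradiction under ¬under

  ⊤-closed-absurd : ∀ k F {e} → Closed L ⊤ F → e ∈ˡ F → (∀ {f} → f ∈ˡ F → HasKind k f) → Empty.⊥
  ⊤-closed-absurd (inj₁ i) F closed e∈F hasKind = FullyClosed.Crowded.absurd F closed e∈F i hasKind
  ⊤-closed-absurd (inj₂ (z , x)) F closed e∈F hasKind = FullyClosed.tight-absurd F closed e∈F (proj₁ (hasKind e∈F))
    (λ f∈F → proj₁ (proj₂ (hasKind f∈F))) (λ f∈F → proj₂ (proj₂ (hasKind f∈F)))

  closed-absurd : ∀ k N F {e} → Closed L N F → e ∈ˡ F → (∀ {f} → f ∈ˡ F → load (proj₁ f) < 2) → (∀ {f} → f ∈ˡ F → HasKind k f) → Empty.⊥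
  closed-absurd k N F {e} closed e∈F under hasKind =
      byCase (N-cases N F closed e∈F (≤-trans (s≤s (s≤s z≤n)) (≤-reflexive (sym b≡r-1))))
    where
    byCase : ∣ N ∣ ≡ 1 ⊎ (a ≤ 1 × b < ∣ N ∣) ⊎ (a ≡ 2 × b ≡ 2 × ∣ N ∣ ≡ 3) → Empty.⊥
    byCase (inj₁ ∣N∣≡1) = let i , special = special-singleton N F closed e∈F ∣N∣≡1
                          in <⇒≱ (under {e} e∈F) (special⇒loaded e i special)
    byCase (inj₂ (inj₁ (_ , b<∣N∣))) = ⊤-closed-absurd k F (subst (λ N → Closed L N F) N≡⊤ closed) e∈F hasKind
      where
      N≡⊤ : N ≡ ⊤
      N≡⊤ = ∣p∣≡n⇒p≡⊤ (≤-antisym (∣p∣≤n N) (≤-trans (≤-reflexive (cong suc (sym b≡r-1))) b<∣N∣))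
    byCase (inj₂ (inj₂ (a≡2 , _))) = contradiction (trans (sym a≡1) a≡2) λ ()

  oneTrunk : numEdges H ≤ t * shadowSize H + length (kinds r) * (familyConstant L₀ (1 + ρ) * n ^ (1 + ρ))
  oneTrunk = sparse c 2 capacity (length (kinds r) * (familyConstant L₀ (1 + ρ) * n ^ (1 + ρ))) (s≤s z≤n) λ F uF under →
    length≤labels*class _≟ₖ_ (kinds r) ℓ (λ e → ∈-kinds (ℓ e)) F (familyConstant L₀ (1 + ρ) * n ^ (1 + ρ)) λ k →
      noClosed⇒length≤ {Edge} {1 + ρ} {n} L₀ co co-ext (filter (λ e → ℓ e ≟ₖ k) F) (Unique.filter⁺ (λ e → ℓ e ≟ₖ k) uF)
        λ N F′ {e} F′⊆ e∈F′ closed → closed-absurd k N F′ {e} closed e∈F′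
          (λ {f} f∈ → under {f} (proj₁ (∈-filter⁻ (λ e → ℓ e ≟ₖ k) {xs = F} (F′⊆ f∈))))
          (λ {f} f∈ → let f∈F , ℓf≡k = ∈-filter⁻ (λ e → ℓ e ≟ₖ k) {xs = F} (F′⊆ f∈)
                      in subst (λ k → HasKind k f) ℓf≡k (kind-correct f (load (proj₁ f) <? 2) (under {f} f∈F)))
    where
    ℓ : Edge → Kind r
    ℓ e = kind e (load (proj₁ e) <? 2)

-- The constant and the distinction of cases

theorem3 : (r s h : ℕ) → 2 ≤ s → 1 ≤ h → 3 ≤ r →
    Σ ℕ λ C → 0 < C ×
    ((a b : ℕ) → 1 ≤ a → 1 ≤ b → a + b ≡ r →
    ((a ≡ 1 × b ≡ r ∸ 1) → h ≡ 1) →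
    (n : ℕ) (H : Hypergraph r n) →
    (s ∸ 1) * shadowSize H + C * n ^ (r ∸ 2) < numEdges H →
    ContainsBush H a b s h)
theorem3 r@(suc (suc (suc ρ))) s@(suc (suc t)) h (s≤s (s≤s _)) _ (s≤s (s≤s (s≤s _))) = suc (M + κ * M) , s≤s z≤n , contains
  where
  -- The constant is fixed before `a` and `b`, so it dominates both `M` and the bound `κ * M` of the
  -- case `a = 1`; the successor makes it positive.
  M κ : ℕ
  M = familyConstant (Sizes.L₀ r s h) (1 + ρ)
  κ = length (kinds r)
  contains : (a b : ℕ) → 1 ≤ a → 1 ≤ b → a + b ≡ r → ((a ≡ 1 × b ≡ r ∸ 1) → h ≡ 1) → (n : ℕ) (H : Hypergraph r n) →
    (s ∸ 1) * shadowSize H + suc (M + κ * M) * n ^ (r ∸ 2) < numEdges H → ContainsBush H a b s h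
  contains a b 1≤a 1≤b a+b≡r h-cond n H dense = decidable-stable (ContainsBush? H a b s h) λ ¬bush →
    <⇒≱ dense (sparse ¬bush)
    where
    X = n ^ (1 + ρ)
    M≤ : M * X ≤ suc (M + κ * M) * X
    M≤ = *-monoˡ-≤ X (≤-trans (m≤m+n M (κ * M)) (n≤1+n _))
    κM≤ : κ * (M * X) ≤ suc (M + κ * M) * X
    κM≤ = ≤-trans (≤-reflexive (sym (*-assoc κ M X))) (*-monoˡ-≤ X (≤-trans (m≤n+m (κ * M) M) (n≤1+n _)))
    sparse : ¬ ContainsBush H a b s h → numEdges H ≤ (s ∸ 1) * shadowSize H + suc (M + κ * M) * X
    sparse ¬bush with a ℕ.≟ 1
    ... | yes a≡1 = ≤-trans
      (OneTrunk.oneTrunk H a b (suc t) h a+b≡r 1≤a 1≤b ¬bush a≡1 (h-cond (a≡1 , b≡r-1)) (s≤s z≤n))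
      (+-monoʳ-≤ ((s ∸ 1) * shadowSize H) κM≤)
      where
      b≡r-1 : b ≡ r ∸ 1
      b≡r-1 = cong pred (trans (cong (_+ b) (sym a≡1)) a+b≡r)
    ... | no a≢1 with (a ℕ.≟ 2) ×-dec (b ℕ.≟ 2)
    ...   | yes (a≡2 , b≡2) = ≤-trans (TwoTwo.twoTwo H a b s h a+b≡r 1≤a 1≤b (s≤s z≤n) ¬bush a≡2 b≡2)
              (+-monoʳ-≤ ((s ∸ 1) * shadowSize H) M≤)
    ...   | no ¬2,2 = ≤-trans (Cases.generic H a b s h a+b≡r 1≤a 1≤b (s≤s z≤n) ¬bush
                (λ _ → ≤∧≢⇒< 1≤a (a≢1 ∘ sym) , ¬2,2))
              (+-monoʳ-≤ ((s ∸ 1) * shadowSize H) M≤)
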